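{- Let $n\ge1$. The map $\Omega:\mathsf{HBPD}(n)\to\mathsf{DT}(n-1)$ is a shape preserving bijection. Furthermore, if $\mathcal P\in\mathsf{HBPD}(n)$ lies in $\mathsf{Pipes}(w)$, then the column reading word of $\Omega(\mathcal P)$ is a Hecke word for $w$.
   Context: Bumpless pipe dreams. Cells $(i,j)$ of the $n\times n$ grid: row $i$ from the top, column $j$ from the left. There are six tiles: downward elbow (a pipe joining the bottom and right edges), upward elbow (a pipe joining the left and top edges), crossing (one pipe joining left and right edges and one joining bottom and top edges), blank (no pipe), horizontal (a pipe joining left and right edges), vertical (a pipe joining bottom and top edges). A bumpless pipe dream (BPD) of size $n$ is a tiling of the $n\times n$ grid by these tiles such that an edge shared by two cells is met by a pipe from both sides or from neither, every edge on the bottom and right boundaries of the grid is met by a pipe, and no edge on the left or top boundary is met by a pipe. $D(\mathcal P)$ is the set of positions of blank tiles of $\mathcal P$. Demazure product $\partial(\mathcal P)\in S_n$: label the bottom boundary edges $1,\dots,n$ from left to right and propagate labels along pipes north and east; at a crossing tile, of the two labels entering from the left and from below, the smaller leaves through the right edge and the larger through the top edge. $\partial(\mathcal P)(i)$ is the label arriving at the right boundary edge of row $i$. $\mathsf{Pipes}(w)=\{\mathcal P:\partial(\mathcal P)=w\}$. For a partition $\lambda$, $\mathbb Y(\lambda)=\{(i,j):1\le j\le\lambda_i\}$. A BPD $\mathcal P$ is Hecke, of shape $\lambda$, if $D(\mathcal P)=\mathbb Y(\lambda)$ for some partition $\lambda$. $\mathsf{HBPD}(n)$ is the set of Hecke BPDs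 of size $n$. A decreasing tableau of shape $\lambda$ is a function $\mathbb Y(\lambda)\to\{1,2,\dots\}$ whose values strictly decrease along rows (left to right) and down columns. $\mathsf{DT}(n-1)$ is the set of decreasing tableaux (of all partition shapes, including the empty one) with entries in $\{1,\dots,n-1\}$. The column reading word reads the entries along columns from bottom to top, taking the columns from left to right. Hecke words: in the Demazure algebra, the free $\mathbb Z$-module with basis $\{e_w:w\in S_n\}$ and product determined by $e_we_{s_i}=e_{ws_i}$ if $\ell(ws_i)>\ell(w)$ and $e_we_{s_i}=e_w$ otherwise ($s_i=(i\ i+1)$), a word $(a_1,\dots,a_k)$ with letters in $\{1,\dots,n-1\}$ is a Hecke word for $w$ if $e_{s_{a_1}}\cdots e_{s_{a_k}}=e_w$. The map $\Omega$: in each diagonal $\{(i,j):j-i=c\}$ of a BPD there are as many blank tiles as crossing tiles. Ordering each diagonal from northwest to southeast, pair the first blank tile with the last crossing tile, the second blank tile with the second-to-last crossing tile, and so on. For $\mathcal P\in\mathsf{HBPD}(n)$, $\Omega(\mathcal P)$ is the filling of $D(\mathcal P)$ in which a blank cell in row $i$ whose paired crossing tile is in row $i'$ receives the value $i'-i$. -}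

module Defs where

open import Data.Bool using (Bool; true; false; if_then_else_)
open import Data.Fin using (Fin; zero; suc; toℕ; inject₁)
import Data.Fin as Fin
import Data.Fin.Properties as Fin
open import Data.Fin.Permutation using (Permutation′; _⟨$⟩ʳ_; _∘ₚ_; transpose)
import Data.Fin.Permutation as Perm
open import Data.Integer using (ℤ; +_; 0ℤ; 1ℤ; _⊖_)
import Data.Integer as ℤ
open import Data.List using (List; []; _∷_; length; map; filter; reverse; zip; foldl; foldr;
  mapMaybe; concatMap; upTo; downFrom; cartesianProduct; allFin)
open import Data.List.Relation.Unary.All using (All)
open import Data.List.Relation.Unary.Linked using (Linked)
open import Data.List.Membership.Propositional using () renaming (_∈_ to _∈ˡ_)
open import Data.Maybe using (Maybe; just; nothing; zipWith)
open import Data.Nat using (ℕ; zero; suc; _≤_; _<_; _>_; _≥_; _⊓_; _⊔_; _<?_)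
open import Data.Product using (Σ-syntax; ∃₂; _×_; _,_; proj₁; proj₂)
open import Data.Vec using (Vec; []; _∷_; lookup; tabulate)
open import Relation.Binary.Definitions using (Decidable)
open import Relation.Binary.PropositionalEquality using (_≡_; refl)
open import Relation.Nullary using (Dec; yes; no; does)
open import Relation.Nullary.Decidable using (_×-dec_)
open import Relation.Unary using (Pred; _∈_; _≐_)
open import Level using (0ℓ)

-- Rows, columns, pipe labels and the points permuted by S_n are all numbered
-- from 0.  Letters of words and entries of tableaux keep their actual values
-- 1, …, n - 1.

------------------------------------------------------------------------
-- Partitions

record Partition : Set where
  constructor mkPartition
  field
    parts      : List ℕ
    decreasing : Linked _≥_ parts
    positive   : All (_> 0) parts

open Partition public

-- Partitions are compared by their parts, not by the proofs about them.
infix 4 _≈ᵖ_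
_≈ᵖ_ : Partition → Partition → Set
ƛ ≈ᵖ μ = parts ƛ ≡ parts μ

nth : List ℕ → ℕ → ℕ
nth []       _       = 0
nth (x ∷ xs) zero    = x
nth (x ∷ xs) (suc i) = nth xs i

infixl 9 _!_
_!_ : Partition → ℕ → ℕ
ƛ ! i = nth (parts ƛ) i

𝕐 : Partition → Pred (ℕ × ℕ) 0ℓ
𝕐 ƛ (i , j) = j < ƛ ! i

------------------------------------------------------------------------
-- Bumpless pipe dreams

data Tile : Set where
  downElbow upElbow crossing blank horizontal vertical : Tile

_≟ᵗ_ : Decidable {A = Tile} _≡_
downElbow  ≟ᵗ downElbow  = yes refl
downElbow  ≟ᵗ upElbow    = no λ ()
downElbow  ≟ᵗ crossing   = no λ ()
downElbow  ≟ᵗ blank      = no λ ()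
downElbow  ≟ᵗ horizontal = no λ ()
downElbow  ≟ᵗ vertical   = no λ ()
upElbow    ≟ᵗ downElbow  = no λ ()
upElbow    ≟ᵗ upElbow    = yes refl
upElbow    ≟ᵗ crossing   = no λ ()
upElbow    ≟ᵗ blank      = no λ ()
upElbow    ≟ᵗ horizontal = no λ ()
upElbow    ≟ᵗ vertical   = no λ ()
crossing   ≟ᵗ downElbow  = no λ ()
crossing   ≟ᵗ upElbow    = no λ ()
crossing   ≟ᵗ crossing   = yes refl
crossing   ≟ᵗ blank      = no λ ()
crossing   ≟ᵗ horizontal = no λ ()
crossing   ≟ᵗ vertical   = no λ ()
blank      ≟ᵗ downElbow  = no λ ()
blank      ≟ᵗ upElbow    = no λ ()
blank      ≟ᵗ crossing   = no λ ()
blank      ≟ᵗ blank      = yes refl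
blank      ≟ᵗ horizontal = no λ ()
blank      ≟ᵗ vertical   = no λ ()
horizontal ≟ᵗ downElbow  = no λ ()
horizontal ≟ᵗ upElbow    = no λ ()
horizontal ≟ᵗ crossing   = no λ ()
horizontal ≟ᵗ blank      = no λ ()
horizontal ≟ᵗ horizontal = yes refl
horizontal ≟ᵗ vertical   = no λ ()
vertical   ≟ᵗ downElbow  = no λ ()
vertical   ≟ᵗ upElbow    = no λ ()
vertical   ≟ᵗ crossing   = no λ ()
vertical   ≟ᵗ blank      = no λ ()
vertical   ≟ᵗ horizontal = no λ ()
vertical   ≟ᵗ vertical   = yes refl

-- Whether a pipe of the tile meets the given edge of its cell.
left right top bottom : Tile → Bool

left downElbow  = false
left upElbow    = true
left crossing   = true
left blank      = false
left horizontal = true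
left vertical   = false

right downElbow  = true
right upElbow    = false
right crossing   = true
right blank      = false
right horizontal = true
right vertical   = false

top downElbow  = false
top upElbow    = true
top crossing   = true
top blank      = false
top horizontal = false
top vertical   = true

bottom downElbow  = true
bottom upElbow    = false
bottom crossing   = true
bottom blank      = false
bottom horizontal = false
bottom vertical   = true

-- The list of rows, from the top.
Tiling : ℕ → Set
Tiling n = Vec (Vec Tile n) n

Cell : ℕ → Set
Cell n = Fin n × Fin n

infixl 9 _at_
_at_ : ∀ {n} → Tiling n → Cell n → Tile
t at (i , j) = lookup (lookup t i) j

record BPD (n : ℕ) : Set where
  field
    tiling : Tiling n
    match-horizontal : ∀ i {j j′} → toℕ j′ ≡ suc (toℕ j) →
                       right (tiling at (i , j)) ≡ left (tiling at (i , j′))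
    match-vertical   : ∀ {i i′} j → toℕ i′ ≡ suc (toℕ i) →
                       bottom (tiling at (i , j)) ≡ top (tiling at (i′ , j))
    left-boundary    : ∀ i j → toℕ j ≡ 0 → left (tiling at (i , j)) ≡ false
    top-boundary     : ∀ i j → toℕ i ≡ 0 → top (tiling at (i , j)) ≡ false
    right-boundary   : ∀ i j → suc (toℕ j) ≡ n → right (tiling at (i , j)) ≡ true
    bottom-boundary  : ∀ i j → suc (toℕ i) ≡ n → bottom (tiling at (i , j)) ≡ true

open BPD public using (tiling)

D : ∀ {n} → BPD n → Pred (ℕ × ℕ) 0ℓ
D P (a , b) = ∃₂ λ i j → toℕ i ≡ a × toℕ j ≡ b × tiling P at (i , j) ≡ blank

record HBPD (n : ℕ) : Set where
  field
    bpd     : BPD n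
    shape   : Partition
    D≐shape : D bpd ≐ 𝕐 shape

open HBPD public using (bpd)

-- The shape is determined by the tiling.
infix 4 _≈ʰ_
_≈ʰ_ : ∀ {n} → HBPD n → HBPD n → Set
P ≈ʰ Q = tiling (bpd P) ≡ tiling (bpd Q)

------------------------------------------------------------------------
-- The permutation of a bumpless pipe dream

-- The label on an edge; nothing on an edge that no pipe meets.
Label : Set
Label = Maybe ℕ

-- Labels on the left and bottom edges ↦ labels on the right and top edges.
propagate : Tile → Label → Label → Label × Label
propagate downElbow  l b = b , nothing
propagate upElbow    l b = nothing , l
propagate crossing   l b = zipWith _⊓_ l b , zipWith _⊔_ l b
propagate blank      l b = nothing , nothing
propagate horizontal l b = l , nothing
propagate vertical   l b = nothing , b

-- One row, from left to right: the label entering on the left and the labels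
-- entering from below ↦ the label leaving on the right and the labels leaving
-- through the top.
propagateRow : ∀ {m} → Vec Tile m → Label → Vec Label m → Label × Vec Label m
propagateRow []       l []       = l , []
propagateRow (t ∷ ts) l (b ∷ bs) =
  let r  , u  = propagate t l b
      r′ , us = propagateRow ts r bs
  in  r′ , u ∷ us

-- Several rows, from the bottom one up: the labels entering from below ↦ the
-- labels leaving on the right, by row, and those leaving through the top.
propagateRows : ∀ {k m} → Vec (Vec Tile m) k → Vec Label m → Vec Label k × Vec Label m
propagateRows []         bs = [] , bs
propagateRows (ts ∷ tss) bs =
  let rs , us = propagateRows tss bs
      r , us′ = propagateRow ts nothing us
  in  r ∷ rs , us′

∂ : ∀ {n} → BPD n → Fin n → Label
∂ P = lookup (proj₁ (propagateRows (tiling P) (tabulate (λ j → just (toℕ j)))))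

Pipes : ∀ {n} → Permutation′ n → Pred (BPD n) 0ℓ
Pipes w P = ∀ i → ∂ P i ≡ just (toℕ (w ⟨$⟩ʳ i))

------------------------------------------------------------------------
-- Decreasing tableaux

-- DT m consists of the decreasing tableaux with entries in {1, …, m}.
record DT (m : ℕ) : Set where
  field
    shape     : Partition
    entry     : (i j : ℕ) → .((i , j) ∈ 𝕐 shape) → ℕ
    row-dec   : ∀ {i j j′} .(p : (i , j) ∈ 𝕐 shape) .(p′ : (i , j′) ∈ 𝕐 shape) →
                j < j′ → entry i j p > entry i j′ p′
    col-dec   : ∀ {i i′ j} .(p : (i , j) ∈ 𝕐 shape) .(p′ : (i′ , j) ∈ 𝕐 shape) →
                i < i′ → entry i j p > entry i′ j p′
    entry-pos : ∀ {i j} .(p : (i , j) ∈ 𝕐 shape) → 1 ≤ entry i j p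
    entry-≤   : ∀ {i j} .(p : (i , j) ∈ 𝕐 shape) → entry i j p ≤ m

open DT public using (entry)

infix 4 _≈ᵗ_
_≈ᵗ_ : ∀ {m} → DT m → DT m → Set
S ≈ᵗ T = DT.shape S ≈ᵖ DT.shape T ×
         (∀ i j .(p : (i , j) ∈ 𝕐 (DT.shape S)) .(q : (i , j) ∈ 𝕐 (DT.shape T)) →
          entry S i j p ≡ entry T i j q)

entry? : ∀ {m} → DT m → ℕ → ℕ → Maybe ℕ
entry? T i j with j <? DT.shape T ! i
... | yes p = just (entry T i j p)
... | no  _ = nothing

columnWord : ∀ {m} → DT m → List ℕ
columnWord T = concatMap column (upTo (ƛ ! 0))
  where
  ƛ = DT.shape T

  column : ℕ → List ℕ
  column j = mapMaybe (λ i → entry? T i j) (downFrom (length (parts ƛ)))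

------------------------------------------------------------------------
-- The map Ω

cells : ∀ n → List (Cell n)
cells n = cartesianProduct (allFin n) (allFin n)

-- cells is in row-major order, so each diagonal runs from northwest to
-- southeast.
diagonal : ∀ n → ℤ → List (Cell n)
diagonal n c = filter (λ (i , j) → (toℕ j ⊖ toℕ i) ℤ.≟ c) (cells n)

tilesOn : ∀ {n} → BPD n → Tile → ℤ → List (Cell n)
tilesOn P t c = filter (λ x → (tiling P at x) ≟ᵗ t) (diagonal _ c)

-- The two lists have the same length, so zip discards nothing.
pairs : ∀ {n} → BPD n → ℤ → List (Cell n × Cell n)
pairs P c = zip (tilesOn P blank c) (reverse (tilesOn P crossing c))

Paired : ∀ {n} → BPD n → Cell n → Cell n → Set
Paired P (i , j) y = ((i , j) , y) ∈ˡ pairs P (toℕ j ⊖ toℕ i)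

-- T is the filling Ω(P); these conditions determine T up to _≈ᵗ_.
record IsΩ {n m : ℕ} (P : HBPD n) (T : DT m) : Set where
  field
    domain : D (bpd P) ≐ 𝕐 (DT.shape T)
    value  : ∀ (i j : Fin n) .(p : (toℕ i , toℕ j) ∈ 𝕐 (DT.shape T)) →
             ∃₂ λ i′ j′ → Paired (bpd P) (i , j) (i′ , j′) ×
                          + entry T (toℕ i) (toℕ j) p ≡ toℕ i′ ⊖ toℕ i

------------------------------------------------------------------------
-- The Demazure algebra and Hecke words

-- The Coxeter length, as the number of inversions.
ℓ : ∀ {n} → Permutation′ n → ℕ
ℓ {n} w = length (filter (λ (a , b) → (a Fin.<? b) ×-dec ((w ⟨$⟩ʳ b) Fin.<? (w ⟨$⟩ʳ a)))
                         (cells n))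

-- i : Fin m stands for the letter i + 1 ∈ {1, …, m}.
letter : ∀ {m} → Fin m → ℕ
letter i = suc (toℕ i)

s : ∀ {m} → Fin m → Permutation′ (suc m)
s i = transpose (inject₁ i) (suc i)

-- The permutation w s_i; _∘ₚ_ applies its left argument first.
_·s_ : ∀ {m} → Permutation′ (suc m) → Fin m → Permutation′ (suc m)
w ·s i = s i ∘ₚ w

_≟ₚ_ : ∀ {n} (u v : Permutation′ n) → Dec (u Perm.≈ v)
u ≟ₚ v = Fin.all? (λ i → (u ⟨$⟩ʳ i) Fin.≟ (v ⟨$⟩ʳ i))

-- The free ℤ-module on S_n: formal sums of terms z·e_w, equal when they have
-- the same coefficients.
Demazure : ℕ → Set
Demazure n = List (ℤ × Permutation′ n)

coeff : ∀ {n} → Demazure n → Permutation′ n → ℤ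
coeff x w = foldr (λ (z , u) c → if does (u ≟ₚ w) then z ℤ.+ c else c) 0ℤ x

infix 4 _≋_
_≋_ : ∀ {n} → Demazure n → Demazure n → Set
x ≋ y = ∀ w → coeff x w ≡ coeff y w

e : ∀ {n} → Permutation′ n → Demazure n
e w = (1ℤ , w) ∷ []

-- e_w · e_{s_i} = e_{w ⋆ i}
_⋆_ : ∀ {m} → Permutation′ (suc m) → Fin m → Permutation′ (suc m)
w ⋆ i = if does (ℓ w <? ℓ (w ·s i)) then w ·s i else w

-- Right multiplication by e_{s_i}, by linearity.  The products defining Hecke
-- words only involve multiplications of this kind.
_·e_ : ∀ {m} → Demazure (suc m) → Fin m → Demazure (suc m)
x ·e i = map (λ (z , w) → z , w ⋆ i) x

-- e_{s_{a₁}} ⋯ e_{s_{aₖ}}, multiplied out from the left starting at the unit.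
e-product : ∀ {m} → List (Fin m) → Demazure (suc m)
e-product = foldl _·e_ (e Perm.id)

IsHeckeWord : ∀ {m} → Permutation′ (suc m) → List ℕ → Set
IsHeckeWord {m} w as = Σ[ is ∈ List (Fin m) ] as ≡ map letter is × e-product is ≋ e w

{-# OPTIONS --safe #-}

-- Let r(a, b) be the number of pipes passing northwest of the vertex (a, b).
-- Neighbouring values of r differ by 0 or 1, the tile of a cell is determined by
-- the four values at its corners, and along a diagonal r grows by 0 at a blank,
-- by 2 at a crossing and by 1 at any other tile.  A bumpless pipe dream is Hecke
-- iff r vanishes at the southeast corner of every blank, and then Ω(P) = T, extended by
-- 0, is the unique filling with
--   k < T(i, j)  ⇔  r(i + k + 1, j + k + 1) ≤ k        (rows and columns from 0),
-- because the crossing paired with (i, j) is the last cell of its diagonal whose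
-- northwest vertex satisfies this inequality.  The equivalence determines r from
-- T and T from r, and it exchanges the increments of r with the decrease of T.
--
-- For the Hecke word, the crossing paired with a blank of entry k + 1 has height k
-- at its northwest vertex, so it acts on the labels along a sweep as the Demazure
-- generator of the letter k + 1.  Sweeping the rows from the bottom up therefore
-- computes ∂(P) as the Demazure product of the entries of T in the order of their
-- crossings, and that order disagrees with the column reading order only on pairs
-- of letters that commute.

module Submission where

open import Defs
open import Algebra.Properties.AbelianGroup using (∙-cancelʳ)
open import Data.Bool using (Bool; true; false; if_then_else_)
open import Data.Empty using (⊥-elim)
open import Data.Fin using (Fin; zero; suc; toℕ; inject₁; fromℕ<)
import Data.Fin as Fin
open import Data.Fin.Permutation using (Permutation′; _⟨$⟩ʳ_)
import Data.Fin.Permutation as Perm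
import Data.Fin.Properties as Fin
open import Data.Integer using (ℤ; 0ℤ; 1ℤ; _⊖_)
import Data.Integer as ℤ
import Data.Integer.Properties as ℤ
open import Data.List using (List; []; _∷_; _++_; applyUpTo; cartesianProduct; catMaybes;
  concatMap; downFrom; filter; foldl; fromMaybe; length; map; mapMaybe; reverse; upTo; zip)
import Data.List as List
import Data.List.Properties as List
open import Data.List.Membership.Propositional using () renaming (_∈_ to _∈ˡ_)
open import Data.List.Membership.Propositional.Properties
open import Data.List.Relation.Unary.All as All using (All; []; _∷_)
import Data.List.Relation.Unary.All.Properties as All
open import Data.List.Relation.Unary.AllPairs as AllPairs using (AllPairs; []; _∷_)
import Data.List.Relation.Unary.AllPairs.Properties as AllPairs
open import Data.List.Relation.Unary.Any using (here; there)
import Data.List.Relation.Unary.Any.Properties as Any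
open import Data.List.Relation.Unary.Linked using (Linked; []; [-]; _∷_)
open import Data.List.Relation.Unary.Unique.Propositional using (Unique)
import Data.List.Relation.Unary.Unique.Propositional.Properties as Unique
open import Data.Maybe using (Maybe; just; nothing)
open import Data.Nat using (ℕ; zero; suc; _+_; _∸_; _≤_; _<_; _>_; _≥_; z≤n; s≤s; _⊔_; _⊓_;
  _<?_; _≤?_; _≤′_; ≤′-reflexive; ≤′-refl; ≤′-step)
import Data.Nat.Properties as ℕ
open import Data.Nat.Tactic.RingSolver using (solve-∀)
open import Data.Product using (Σ-syntax; ∃; ∃₂; _×_; _,_; proj₁; proj₂)
open import Data.Sum using (_⊎_; inj₁; inj₂; map₁; map₂)
open import Data.Vec using (Vec; []; _∷_; lookup)
import Data.Vec as Vec
import Data.Vec.Properties as Vec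
open import Function using (_∘_; flip)
open import Function.Bundles using (_⇔_; mk⇔; Equivalence)
open import Function.Structures using (IsBijection)
open import Relation.Binary.Definitions using (tri<; tri≈; tri>)
open import Relation.Binary.PropositionalEquality
open import Relation.Binary.Structures using (IsEquivalence)
open import Relation.Nullary using (¬_; Dec; yes; no; does)
open import Relation.Nullary.Decidable using (dec-true; dec-false; does-⇔; recompute; _×-dec_)
open import Relation.Unary using (_∈_; _≐_)

open Equivalence using (to; from)

-- Sorting words

-- The action of a Demazure generator on one-line notations.
sortAt : List ℕ → ℕ → List ℕ
sortAt []           k       = []
sortAt (x ∷ [])     k       = x ∷ []
sortAt (x ∷ y ∷ xs) zero    = x ⊔ y ∷ x ⊓ y ∷ xs
sortAt (x ∷ y ∷ xs) (suc k) = x ∷ sortAt (y ∷ xs) k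

-- Letters whose generators act on disjoint pairs of neighbouring positions and therefore commute.
Far : ℕ → ℕ → Set
Far j k = 2 + j ≤ k ⊎ 2 + k ≤ j

sortAt-tail : ∀ x xs k → sortAt (x ∷ xs) (suc k) ≡ x ∷ sortAt xs k
sortAt-tail x []       k = refl
sortAt-tail x (y ∷ xs) k = refl

sortAt-comm-≤ : ∀ {j k} xs → 2 + j ≤ k → sortAt (sortAt xs j) k ≡ sortAt (sortAt xs k) j
sortAt-comm-≤ []           _   = refl
sortAt-comm-≤ (x ∷ [])     _   = refl
sortAt-comm-≤ {zero} {suc (suc k)} (x ∷ y ∷ xs) (s≤s (s≤s _))
  rewrite sortAt-tail (x ⊓ y) xs k | sortAt-tail y xs k = refl
sortAt-comm-≤ {suc j} {suc k} (x ∷ y ∷ xs) (s≤s p)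
  rewrite sortAt-tail x (sortAt (y ∷ xs) j) k | sortAt-tail x (sortAt (y ∷ xs) k) j =
  cong (x ∷_) (sortAt-comm-≤ (y ∷ xs) p)

sortAt-comm : ∀ {j k} xs → Far j k → sortAt (sortAt xs j) k ≡ sortAt (sortAt xs k) j
sortAt-comm xs (inj₁ p) = sortAt-comm-≤ xs p
sortAt-comm xs (inj₂ p) = sym (sortAt-comm-≤ xs p)

sortAt-++ : ∀ xs ys k → sortAt (xs ++ ys) (length xs + k) ≡ xs ++ sortAt ys k
sortAt-++ []       ys k = refl
sortAt-++ (x ∷ xs) ys k =
  trans (sortAt-tail x (xs ++ ys) _) (cong (x ∷_) (sortAt-++ xs ys k))

-- Sorted lists and rearrangement of words

module _ {A : Set} where

  AllPairs-remove : ∀ {R : A → A → Set} us {x vs} → AllPairs R (us ++ x ∷ vs) →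
                    All (flip R x) us × All (R x) vs × AllPairs R (us ++ vs)
  AllPairs-remove []       (p ∷ ps) = [] , p , ps
  AllPairs-remove (u ∷ us) (p ∷ ps) =
    let q , r , t = AllPairs-remove us ps
    in  All.head (All.++⁻ʳ us p) ∷ q , r , All.++⁺ (All.++⁻ˡ us p) (All.tail (All.++⁻ʳ us p)) ∷ t

  ∈-remove : ∀ us {x y : A} {vs} → ¬ y ≡ x → y ∈ˡ us ++ x ∷ vs → y ∈ˡ us ++ vs
  ∈-remove us y≢x y∈ with ∈-++⁻ us y∈
  ... | inj₁ p            = ∈-++⁺ˡ p
  ... | inj₂ (here refl)  = ⊥-elim (y≢x refl)
  ... | inj₂ (there p)    = ∈-++⁺ʳ us p

  ∈-weaken : ∀ us {x y : A} {vs} → y ∈ˡ us ++ vs → y ∈ˡ us ++ x ∷ vs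
  ∈-weaken us y∈ with ∈-++⁻ us y∈
  ... | inj₁ p = ∈-++⁺ˡ p
  ... | inj₂ p = ∈-++⁺ʳ us (there p)

  -- If the heads differed, each would lie in the tail of the other list, and sortedness would
  -- relate them both ways. This later identifies the reversed crossings of a diagonal.
  sorted-unique : ∀ {R : A → A → Set} → (∀ {x y} → R x y → ¬ R y x) → ∀ {xs ys} →
                  AllPairs R xs → AllPairs R ys → (∀ x → x ∈ˡ xs ⇔ x ∈ˡ ys) → xs ≡ ys
  sorted-unique asym {[]}     {[]}     _ _ _ = refl
  sorted-unique asym {[]}     {y ∷ _}  _ _ e with () ← from (e y) (here refl)
  sorted-unique asym {x ∷ _}  {[]}     _ _ e with () ← to (e x) (here refl)
  sorted-unique {R} asym {x ∷ xs} {y ∷ ys} (p ∷ ps) (q ∷ qs) e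
    with to (e x) (here refl) | from (e y) (here refl)
  ... | there x∈ | there y∈  = ⊥-elim (asym (All.lookup q x∈) (All.lookup p y∈))
  ... | there x∈ | here refl = ⊥-elim (asym (All.lookup q x∈) (All.lookup q x∈))
  ... | here refl | _        = cong (x ∷_) (sorted-unique asym ps qs e′)
    where
    e′ : ∀ z → z ∈ˡ xs ⇔ z ∈ˡ ys
    e′ z = mk⇔ tail⁺ tail⁻
      where
      tail⁺ : z ∈ˡ xs → z ∈ˡ ys
      tail⁺ z∈ with to (e z) (there z∈)
      ... | there z∈′ = z∈′
      ... | here refl = ⊥-elim (asym (All.lookup p z∈) (All.lookup p z∈))
      tail⁻ : z ∈ˡ ys → z ∈ˡ xs
      tail⁻ z∈ with from (e z) (there z∈)
      ... | there z∈′ = z∈′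
      ... | here refl = ⊥-elim (asym (All.lookup q z∈) (All.lookup q z∈))

  module _ (f : A → ℕ) where

    sortAlong : List ℕ → List A → List ℕ
    sortAlong = foldl λ s x → sortAt s (f x)

    sortAlong-front : ∀ s us {x vs} → All (λ y → Far (f y) (f x)) us →
                      sortAlong s (us ++ x ∷ vs) ≡ sortAlong (sortAt s (f x)) (us ++ vs)
    sortAlong-front s []       []       = refl
    sortAlong-front s (u ∷ us) {x} {vs} (p ∷ ps) =
      trans (sortAlong-front _ us ps) (cong (λ s′ → sortAlong s′ (us ++ vs)) (sortAt-comm s p))

    -- The elements that precede the head x of `xs` in `ys` follow it in `xs`, so the two orders
    -- disagree on them and their letters commute with that of x. Hence x can be moved to the front
    -- of `ys`, and induction applies to the rest. Irreflexivity ensures that no element is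
    -- repeated.
    sortAlong-reorder : ∀ {R S : A → A → Set} → (∀ {x} → ¬ R x x) → (∀ {x} → ¬ S x x) →
      ∀ xs {ys} → AllPairs R xs → AllPairs S ys → (∀ x → x ∈ˡ xs ⇔ x ∈ˡ ys) →
      (∀ {x y} → x ∈ˡ xs → y ∈ˡ xs → R x y → S y x → Far (f y) (f x)) →
      ∀ s → sortAlong s xs ≡ sortAlong s ys
    sortAlong-reorder _ _ [] {[]}    _ _ e _ s = refl
    sortAlong-reorder _ _ [] {y ∷ _} _ _ e _ s with () ← from (e y) (here refl)
    sortAlong-reorder {R} {S} irrR irrS (x ∷ xs) (p ∷ ps) qs e far s
      with ∈-∃++ (to (e x) (here refl))
    ... | us , vs , refl = begin
      sortAlong (sortAt s (f x)) xs         ≡⟨ sortAlong-reorder irrR irrS xs ps qs″ e′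
                                                 (λ x∈ y∈ → far (there x∈) (there y∈)) _ ⟩
      sortAlong (sortAt s (f x)) (us ++ vs) ≡⟨ sortAlong-front s us (All.tabulate far′) ⟨
      sortAlong s (us ++ x ∷ vs)            ∎
      where
      open ≡-Reasoning
      removed = AllPairs-remove us qs
      qs″ = proj₂ (proj₂ removed)
      tail : ∀ {z} → z ∈ˡ us ++ x ∷ vs → ¬ z ≡ x → z ∈ˡ xs
      tail {z} z∈ z≢x with from (e z) z∈
      ... | here z≡x = ⊥-elim (z≢x z≡x)
      ... | there r  = r
      x∉ : ¬ x ∈ˡ us ++ vs
      x∉ x∈ with ∈-++⁻ us x∈
      ... | inj₁ r = irrS (All.lookup (proj₁ removed) r)
      ... | inj₂ r = irrS (All.lookup (proj₁ (proj₂ removed)) r)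
      e′ : ∀ z → z ∈ˡ xs ⇔ z ∈ˡ us ++ vs
      e′ z = mk⇔
        (λ z∈ → ∈-remove us (λ { refl → irrR (All.lookup p z∈) }) (to (e z) (there z∈)))
        (λ z∈ → tail (∈-weaken us z∈) λ { refl → x∉ z∈ })
      far′ : ∀ {y} → y ∈ˡ us → Far (f y) (f x)
      far′ {y} y∈ = far (here refl) (there y∈xs) (All.lookup p y∈xs) y<x
        where
        y<x = All.lookup (proj₁ removed) y∈
        y∈xs = tail (∈-++⁺ˡ y∈) λ { refl → irrS y<x }

-- One-line notation and the Demazure algebra

length-⊆ : ∀ {A : Set} {xs ys : List A} → Unique xs → (∀ {x} → x ∈ˡ xs → x ∈ˡ ys) →
           length xs ≤ length ys
length-⊆ [] _ = z≤n
length-⊆ {xs = x ∷ xs} (p ∷ ps) xs⊆ys with ∈-∃++ (xs⊆ys (here refl))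
... | us , vs , refl = begin
  suc (length xs)             ≤⟨ s≤s (length-⊆ ps λ y∈ → ∈-remove us
                                   (λ { refl → All.lookup p y∈ refl }) (xs⊆ys (there y∈))) ⟩
  suc (length (us ++ vs))     ≡⟨ cong suc (List.length-++ us) ⟩
  suc (length us + length vs) ≡⟨ ℕ.+-suc (length us) (length vs) ⟨
  length us + suc (length vs) ≡⟨ List.length-++ us ⟨
  length (us ++ x ∷ vs)       ∎
  where open ℕ.≤-Reasoning

module _ {m : ℕ} (i : Fin m) where

  private
    σ : Fin (suc m) → Fin (suc m)
    σ = s i ⟨$⟩ʳ_

    lo≢hi : ¬ suc i ≡ inject₁ i
    lo≢hi eq = ℕ.1+n≢n (trans (cong toℕ eq) (Fin.toℕ-inject₁ i))

  s-lo : σ (inject₁ i) ≡ suc i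
  s-lo rewrite dec-true (inject₁ i Fin.≟ inject₁ i) refl = refl

  s-hi : σ (suc i) ≡ inject₁ i
  s-hi rewrite dec-false (suc i Fin.≟ inject₁ i) lo≢hi
             | dec-true (i Fin.≟ i) refl = refl

  s-other : ∀ {k} → ¬ k ≡ inject₁ i → ¬ k ≡ suc i → σ k ≡ k
  s-other {k} k≢lo k≢hi rewrite dec-false (k Fin.≟ inject₁ i) k≢lo
                              | dec-false (k Fin.≟ suc i) k≢hi = refl

  data View : Fin (suc m) → Set where
    lo    : View (inject₁ i)
    hi    : View (suc i)
    other : ∀ {k} → ¬ k ≡ inject₁ i → ¬ k ≡ suc i → View k

  view : ∀ k → View k
  view k with k Fin.≟ inject₁ i | k Fin.≟ suc i
  ... | yes refl | _        = lo
  ... | no _     | yes refl = hi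
  ... | no p     | no q     = other p q

  s-involutive : ∀ k → σ (σ k) ≡ k
  s-involutive k with view k
  ... | lo rewrite s-lo = s-hi
  ... | hi rewrite s-hi = s-lo
  ... | other p q = trans (cong σ (s-other p q)) (s-other p q)

  s-injective : ∀ {a b} → σ a ≡ σ b → a ≡ b
  s-injective {a} {b} eq = trans (sym (s-involutive a)) (trans (cong σ eq) (s-involutive b))

  -- No position lies strictly between the two that are swapped, so only their own pair changes
  -- order.
  s-mono-< : ∀ {a b} → a Fin.< b → ¬ (a ≡ inject₁ i × b ≡ suc i) → σ a Fin.< σ b
  s-mono-< {a} {b} a<b ≢ with view a | view b
  ... | lo | lo = ⊥-elim (ℕ.<-irrefl refl a<b)
  ... | lo | hi = ⊥-elim (≢ (refl , refl))
  ... | lo | other p q rewrite s-lo | s-other p q | Fin.toℕ-inject₁ i =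
    ℕ.≤∧≢⇒< a<b (q ∘ sym ∘ Fin.toℕ-injective)
  ... | hi | lo rewrite Fin.toℕ-inject₁ i = ⊥-elim (ℕ.<-asym a<b ℕ.≤-refl)
  ... | hi | hi = ⊥-elim (ℕ.<-irrefl refl a<b)
  ... | hi | other p q rewrite s-hi | s-other p q | Fin.toℕ-inject₁ i = ℕ.<-trans ℕ.≤-refl a<b
  ... | other p q | lo rewrite s-lo | s-other p q | Fin.toℕ-inject₁ i = ℕ.m<n⇒m<1+n a<b
  ... | other p q | hi rewrite s-hi | s-other p q =
    ℕ.≤∧≢⇒< (subst (toℕ a ≤_) (sym (Fin.toℕ-inject₁ i)) (ℕ.≤-pred a<b)) (p ∘ Fin.toℕ-injective)
  ... | other p q | other p′ q′ rewrite s-other p q | s-other p′ q′ = a<b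

Inversion : ∀ {n} → Permutation′ n → Cell n → Set
Inversion w (a , b) = a Fin.< b × (w ⟨$⟩ʳ b) Fin.< (w ⟨$⟩ʳ a)

inversion? : ∀ {n} (w : Permutation′ n) (c : Cell n) → Dec (Inversion w c)
inversion? w (a , b) = (a Fin.<? b) ×-dec ((w ⟨$⟩ʳ b) Fin.<? (w ⟨$⟩ʳ a))

inversions : ∀ {n} → Permutation′ n → List (Cell n)
inversions w = filter (inversion? w) (cells _)

-- Applying s_i to both positions embeds the inversions of u into those of w,
-- and misses the new inversion (i, i + 1).
ℓ-ascent : ∀ {m} (i : Fin m) (u w : Permutation′ (suc m)) →
           (∀ k → w ⟨$⟩ʳ k ≡ u ⟨$⟩ʳ (s i ⟨$⟩ʳ k)) →
           (u ⟨$⟩ʳ inject₁ i) Fin.< (u ⟨$⟩ʳ suc i) → ℓ u < ℓ w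
ℓ-ascent {m} i u w w≡us u< = begin-strict
  ℓ u                                ≡⟨ List.length-map σ² (inversions u) ⟨
  length (map σ² (inversions u)) <⟨ length-⊆ (All.tabulate new≢ ∷ unique) incl ⟩
  ℓ w                                ∎
  where
  open ℕ.≤-Reasoning
  σ = s i ⟨$⟩ʳ_
  σ² : Cell (suc m) → Cell (suc m)
  σ² (a , b) = σ a , σ b
  wσ : ∀ k → w ⟨$⟩ʳ σ k ≡ u ⟨$⟩ʳ k
  wσ k = trans (w≡us (σ k)) (cong (u ⟨$⟩ʳ_) (s-involutive i k))
  ∈-cells : ∀ c → c ∈ˡ cells (suc m)
  ∈-cells (a , b) = ∈-cartesianProduct⁺ (∈-allFin a) (∈-allFin b)
  unique = Unique.map⁺ {f = σ²}
    (λ eq → cong₂ _,_ (s-injective i (cong proj₁ eq)) (s-injective i (cong proj₂ eq)))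
    (Unique.filter⁺ (inversion? u) (Unique.cartesianProduct⁺ (Unique.allFin⁺ (suc m)) (Unique.allFin⁺ (suc m))))
  inv⁻ : ∀ {c} → c ∈ˡ map σ² (inversions u) → Σ[ (a , b) ∈ Cell (suc m) ]
         c ≡ (σ a , σ b) × Inversion u (a , b)
  inv⁻ c∈ with ∈-map⁻ σ² c∈
  ... | ab , ab∈ , refl = ab , refl , proj₂ (∈-filter⁻ (inversion? u) {xs = cells (suc m)} ab∈)
  new : Cell (suc m)
  new = inject₁ i , suc i
  new≢ : ∀ {c} → c ∈ˡ map σ² (inversions u) → ¬ new ≡ c
  new≢ c∈ eq with inv⁻ c∈
  -- Only the pair (i + 1, i) is sent to the new inversion, and it is not increasing.
  ... | (a , b) , refl , a<b , _ = ℕ.<-asym a<b (subst₂ Fin._<_ (sym b≡) (sym a≡) lo<hi)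
    where
    a≡ : a ≡ suc i
    a≡ = s-injective i (trans (sym (cong proj₁ eq)) (sym (s-hi i)))
    b≡ : b ≡ inject₁ i
    b≡ = s-injective i (trans (sym (cong proj₂ eq)) (sym (s-lo i)))
    lo<hi : inject₁ i Fin.< suc i
    lo<hi = s≤s (ℕ.≤-reflexive (Fin.toℕ-inject₁ i))
  incl : ∀ {c} → c ∈ˡ new ∷ map σ² (inversions u) →
         c ∈ˡ inversions w
  incl (here refl) = ∈-filter⁺ (inversion? w) (∈-cells new)
    ( s≤s (ℕ.≤-reflexive (Fin.toℕ-inject₁ i))
    , subst₂ Fin._<_ (sym (trans (w≡us (suc i)) (cong (u ⟨$⟩ʳ_) (s-hi i))))
                     (sym (trans (w≡us (inject₁ i)) (cong (u ⟨$⟩ʳ_) (s-lo i)))) u<)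
  incl (there c∈) with inv⁻ c∈
  ... | (a , b) , refl , a<b , inv = ∈-filter⁺ (inversion? w) (∈-cells _)
    ( s-mono-< i a<b (λ { (refl , refl) → ℕ.<-asym inv u< })
    , subst₂ Fin._<_ (sym (wσ b)) (sym (wσ a)) inv)

-- A descent of w is an ascent of `w ·s i`, because s_i is an involution. The pointwise hypothesis
-- of `ℓ-ascent` allows this exchange of roles.
ℓ-descent : ∀ {m} (i : Fin m) (w : Permutation′ (suc m)) →
            (w ⟨$⟩ʳ suc i) Fin.< (w ⟨$⟩ʳ inject₁ i) → ℓ (w ·s i) < ℓ w
ℓ-descent i w gt = ℓ-ascent i (w ·s i) w (λ k → cong (w ⟨$⟩ʳ_) (sym (s-involutive i k)))
  (subst₂ Fin._<_ (sym (cong (w ⟨$⟩ʳ_) (s-lo i))) (sym (cong (w ⟨$⟩ʳ_) (s-hi i))) gt)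

oneLine : ∀ {n} → Permutation′ n → List ℕ
oneLine w = List.tabulate (λ k → toℕ (w ⟨$⟩ʳ k))

sortAt-descent : ∀ {m} (i : Fin m) (f : Fin (suc m) → ℕ) → f (suc i) ≤ f (inject₁ i) →
                 sortAt (List.tabulate f) (toℕ i) ≡ List.tabulate f
sortAt-descent zero    f p =
  cong₂ (λ x y → x ∷ y ∷ List.tabulate (λ k → f (suc (suc k)))) (ℕ.m≥n⇒m⊔n≡m p) (ℕ.m≥n⇒m⊓n≡n p)
sortAt-descent {suc m} (suc i) f p = cong (f zero ∷_) (sortAt-descent i (f ∘ suc) p)

sortAt-ascent : ∀ {m} (i : Fin m) (f g : Fin (suc m) → ℕ) → f (inject₁ i) ≤ f (suc i) →
                (∀ k → g k ≡ f (s i ⟨$⟩ʳ k)) → sortAt (List.tabulate f) (toℕ i) ≡ List.tabulate g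
sortAt-ascent i f g p g≡ = go i f g p
  (trans (g≡ _) (cong f (s-lo i))) (trans (g≡ _) (cong f (s-hi i)))
  (λ k q r → trans (g≡ k) (cong f (s-other i q r)))
  where
  go : ∀ {m} (i : Fin m) (f g : Fin (suc m) → ℕ) → f (inject₁ i) ≤ f (suc i) →
       g (inject₁ i) ≡ f (suc i) → g (suc i) ≡ f (inject₁ i) →
       (∀ k → ¬ k ≡ inject₁ i → ¬ k ≡ suc i → g k ≡ f k) →
       sortAt (List.tabulate f) (toℕ i) ≡ List.tabulate g
  go zero f g p g₀ g₁ g₂ = cong₂ _∷_ (trans (ℕ.m≤n⇒m⊔n≡n p) (sym g₀))
    (cong₂ _∷_ (trans (ℕ.m≤n⇒m⊓n≡m p) (sym g₁))
      (List.tabulate-cong (λ k → sym (g₂ (suc (suc k)) (λ ()) (λ ())))))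
  go {suc m} (suc i) f g p g₀ g₁ g₂ = cong₂ _∷_ (sym (g₂ zero (λ ()) (λ ())))
    (go i (f ∘ suc) (g ∘ suc) p g₀ g₁
      (λ k q r → g₂ (suc k) (q ∘ Fin.suc-injective) (r ∘ Fin.suc-injective)))

-- The two length lemmas turn the length test of `⋆` into a comparison of neighbouring values, which
-- are distinct. Putting the larger value first is then a swap at an ascent and does nothing at a
-- descent.
oneLine-⋆ : ∀ {m} (w : Permutation′ (suc m)) (i : Fin m) →
            oneLine (w ⋆ i) ≡ sortAt (oneLine w) (toℕ i)
oneLine-⋆ w i with Fin.<-cmp (w ⟨$⟩ʳ inject₁ i) (w ⟨$⟩ʳ suc i)
... | tri< lt _ _ rewrite dec-true (ℓ w <? ℓ (w ·s i)) (ℓ-ascent i w (w ·s i) (λ _ → refl) lt) =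
  sym (sortAt-ascent i (toℕ ∘ (w ⟨$⟩ʳ_)) _ (ℕ.<⇒≤ lt) (λ _ → refl))
... | tri≈ _ eq _ = ⊥-elim (ℕ.1+n≢n (trans (cong toℕ (sym lo≡hi)) (Fin.toℕ-inject₁ i)))
  where
  lo≡hi : inject₁ i ≡ suc i
  lo≡hi = trans (sym (Perm.inverseˡ w)) (trans (cong (w Perm.⟨$⟩ˡ_) eq) (Perm.inverseˡ w))
... | tri> _ _ gt rewrite dec-false (ℓ w <? ℓ (w ·s i)) (λ lt → ℕ.<-asym lt (ℓ-descent i w gt)) =
  sym (sortAt-descent i (toℕ ∘ (w ⟨$⟩ʳ_)) (ℕ.<⇒≤ gt))

oneLine-foldl : ∀ {m} (is : List (Fin m)) (w : Permutation′ (suc m)) →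
                oneLine (foldl _⋆_ w is) ≡ foldl sortAt (oneLine w) (map toℕ is)
oneLine-foldl []       w = refl
oneLine-foldl (i ∷ is) w =
  trans (oneLine-foldl is (w ⋆ i)) (cong (λ l → foldl sortAt l (map toℕ is)) (oneLine-⋆ w i))

oneLine-injective : ∀ {n} {u w : Permutation′ n} → oneLine u ≡ oneLine w → u Perm.≈ w
oneLine-injective {u = u} {w} eq k = Fin.toℕ-injective (tabulate-injective eq k)
  where
  tabulate-injective : ∀ {n} {f g : Fin n → ℕ} → List.tabulate f ≡ List.tabulate g → ∀ k → f k ≡ g k
  tabulate-injective eq zero    = List.∷-injectiveˡ eq
  tabulate-injective eq (suc k) = tabulate-injective (List.∷-injectiveʳ eq) k

e-cong : ∀ {n} {u w : Permutation′ n} → u Perm.≈ w → e u ≋ e w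
e-cong {u = u} {w} u≈w v = cong (λ b → if b then 1ℤ ℤ.+ 0ℤ else 0ℤ)
  (does-⇔ (mk⇔ (λ p k → trans (sym (u≈w k)) (p k)) (λ p k → trans (u≈w k) (p k))) (u ≟ₚ v) (w ≟ₚ v))

-- Right multiplication by a generator sends a basis element to a basis element, so the formal sum
-- always keeps a single term.
e-product-≡ : ∀ {m} (is : List (Fin m)) w → foldl _·e_ (e w) is ≡ e (foldl _⋆_ w is)
e-product-≡ []       w = refl
e-product-≡ (i ∷ is) w = e-product-≡ is (w ⋆ i)

letters : ∀ {m} {as : List ℕ} → All (λ a → 1 ≤ a × a ≤ m) as →
          Σ[ is ∈ List (Fin m) ] (as ≡ map letter is)
letters []                                = [] , refl
letters {as = suc a ∷ _} ((s≤s _ , a≤m) ∷ ps) =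
  let is , eq = letters ps
  in  fromℕ< a≤m ∷ is , cong₂ _∷_ (cong suc (sym (Fin.toℕ-fromℕ< a≤m))) eq

-- This replaces the algebra by sorting the one-line notation of the identity. Letters are lowered
-- by 1 because `sortAt` numbers positions from 0.
isHeckeWord : ∀ {m} (w : Permutation′ (suc m)) {as : List ℕ} →
              All (λ a → 1 ≤ a × a ≤ m) as →
              foldl sortAt (List.tabulate {n = suc m} toℕ) (map (_∸ 1) as) ≡ oneLine w → IsHeckeWord w as
isHeckeWord {m} w bounds eq with letters bounds
... | is , refl = is , refl , subst (_≋ e w) (sym (e-product-≡ is Perm.id))
  (e-cong {u = foldl _⋆_ Perm.id is} {w} (oneLine-injective
  {u = foldl _⋆_ Perm.id is} {w} (begin
    oneLine (foldl _⋆_ Perm.id is)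
      ≡⟨ oneLine-foldl is Perm.id ⟩
    foldl sortAt start (map toℕ is)
      ≡⟨ cong (foldl sortAt start) (List.map-∘ {g = _∸ 1} {f = letter {m}} is) ⟩
    foldl sortAt start (map (_∸ 1) (map letter is))
      ≡⟨ eq ⟩
    oneLine w ∎)))
  where
  open ≡-Reasoning
  start = List.tabulate {n = suc m} toℕ

-- Heights and tableaux

-- Vertex functions with unit steps correspond to edges that carry a pipe or not. The field
-- `outside` encodes the right and bottom boundary conditions. The field `hecke` encodes the shape
-- condition, since a zero increment along a diagonal marks a blank.
record IsHeight (n : ℕ) (r : ℕ → ℕ → ℕ) : Set where
  field
    top-0   : ∀ b → r 0 b ≡ 0
    left-0  : ∀ a → r a 0 ≡ 0
    right-≤ : ∀ a b → r a b ≤ r a (suc b)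
    right-< : ∀ a b → r a (suc b) ≤ suc (r a b)
    down-≤  : ∀ a b → r a b ≤ r (suc a) b
    down-<  : ∀ a b → r (suc a) b ≤ suc (r a b)
    outside : ∀ a b → n ≤ a ⊎ n ≤ b → r a b ≡ a ⊓ b
    hecke   : ∀ a b → r (suc a) (suc b) ≡ r a b → r (suc a) (suc b) ≡ 0

  ≤-row : ∀ a b → r a b ≤ a
  ≤-row zero    b = ℕ.≤-reflexive (top-0 b)
  ≤-row (suc a) b = ℕ.≤-trans (down-< a b) (s≤s (≤-row a b))

  ≤-col : ∀ a b → r a b ≤ b
  ≤-col a zero    = ℕ.≤-reflexive (left-0 a)
  ≤-col a (suc b) = ℕ.≤-trans (right-< a b) (s≤s (≤-col a b))

  diag-≤ : ∀ a b → r a b ≤ r (suc a) (suc b)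
  diag-≤ a b = ℕ.≤-trans (right-≤ a b) (down-≤ a (suc b))

-- Tableaux are extended by 0 outside their shapes.
record IsTableau (m : ℕ) (T : ℕ → ℕ → ℕ) : Set where
  field
    row   : ∀ i j → 0 < T i (suc j) → T i (suc j) < T i j
    col   : ∀ i j → 0 < T (suc i) j → T (suc i) j < T i j
    bound : ∀ i j → T i j ≤ m

-- Vertices are written as offsets from a cell to avoid subtraction. Those with a coordinate at most
-- k are left out; there a height is at most k by its coordinate bounds.
Dual : (r T : ℕ → ℕ → ℕ) → Set
Dual r T = ∀ k i j → k < T i j ⇔ r (suc (k + i)) (suc (k + j)) ≤ k

transposed : ∀ {m T} → IsTableau m T → IsTableau m (flip T)
transposed t = record { row = flip col ; col = flip row ; bound = flip bound }
  where open IsTableau t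

≤⊎> : ∀ k a → a ≤ k ⊎ Σ[ i ∈ ℕ ] a ≡ suc (k + i)
≤⊎> k       zero    = inj₁ z≤n
≤⊎> zero    (suc a) = inj₂ (a , refl)
≤⊎> (suc k) (suc a) with ≤⊎> k a
... | inj₁ p        = inj₁ (s≤s p)
... | inj₂ (i , eq) = inj₂ (i , cong suc eq)

initial : (P : ℕ → Set) → (∀ k → Dec (P k)) → ℕ → ℕ
initial P P? zero    = zero
initial P P? (suc f) with P? zero
... | no _  = zero
... | yes _ = suc (initial (P ∘ suc) (P? ∘ suc) f)

<-initial : (P : ℕ → Set) (P? : ∀ k → Dec (P k)) → (∀ k → P (suc k) → P k) →
        ∀ f → (∀ k → P k → k < f) → ∀ k → k < initial P P? f ⇔ P k
<-initial P P? down zero    bd k = mk⇔ (λ ()) (bd k)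
<-initial P P? down (suc f) bd k with P? zero
... | no ¬p = mk⇔ (λ ()) (⊥-elim ∘ ¬p ∘ P0 k)
  where
  P0 : ∀ k → P k → P 0
  P0 zero    p = p
  P0 (suc k) p = P0 k (down k p)
<-initial P P? down (suc f) bd zero    | yes p = mk⇔ (λ _ → p) (λ _ → s≤s z≤n)
<-initial P P? down (suc f) bd (suc k) | yes _ =
  mk⇔ (λ { (s≤s q) → to ih q }) (s≤s ∘ from ih)
  where ih = <-initial (P ∘ suc) (P? ∘ suc) (down ∘ suc) f (λ k p → ℕ.≤-pred (bd (suc k) p)) k

module _ {m : ℕ} {r : ℕ → ℕ → ℕ} (h : IsHeight (suc m) r) where
  open IsHeight h

  entryOf : ℕ → ℕ → ℕ
  entryOf i j = initial (λ k → r (suc (k + i)) (suc (k + j)) ≤ k) (λ k → _ ≤? k) m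

  private
    -- Outside the grid the height is the smaller coordinate, here at least k + 1. This is also why
    -- m rounds of search suffice in `entryOf`.
    within : ∀ k i j → r (suc (k + i)) (suc (k + j)) ≤ k → suc (k + i) < suc m × suc (k + j) < suc m
    within k i j p = ℕ.≰⇒> (impossible ∘ inj₁) , ℕ.≰⇒> (impossible ∘ inj₂)
      where
      impossible : ¬ (suc m ≤ suc (k + i) ⊎ suc m ≤ suc (k + j))
      impossible q = ℕ.n≮n k (ℕ.≤-trans (ℕ.⊓-glb (s≤s (ℕ.m≤m+n k i)) (s≤s (ℕ.m≤m+n k j)))
        (ℕ.≤-trans (ℕ.≤-reflexive (sym (outside _ _ q))) p))

  entryOf-dual : Dual r entryOf
  entryOf-dual k i j = <-initial _ _ down m bounded k
    where
    down : ∀ k → r (suc (suc (k + i))) (suc (suc (k + j))) ≤ suc k → r (suc (k + i)) (suc (k + j)) ≤ k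
    down k p with r (suc (k + i)) (suc (k + j)) ≤? k
    ... | yes q = q
    -- Otherwise the height would be k + 1 at both ends of this diagonal step, which `hecke` forbids
    -- for a positive height.
    ... | no ¬q = ⊥-elim (ℕ.1+n≢0 {k} (trans (sym (ℕ.≤-antisym p
                    (ℕ.≤-trans (ℕ.≰⇒> ¬q) (diag-≤ _ _)))) (hecke _ _ (ℕ.≤-antisym
                    (ℕ.≤-trans p (ℕ.≰⇒> ¬q)) (diag-≤ _ _)))))
    bounded : ∀ k → r (suc (k + i)) (suc (k + j)) ≤ k → k < m
    bounded k p = ℕ.≤-trans (s≤s (ℕ.m≤m+n k i)) (ℕ.≤-pred (proj₁ (within k i j p)))

  module _ {T : ℕ → ℕ → ℕ} (dual : Dual r T) where

    -- Going down one row raises the height by at most 1, so `k < T i (suc j)` gives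
    -- `suc k < T i j`: vertical steps yield the decrease along rows. Horizontal steps yield the
    -- decrease down columns.
    dual-tableau : IsTableau m T
    dual-tableau = record { row = row ; col = col ; bound = bound }
      where
      row : ∀ i j → 0 < T i (suc j) → T i (suc j) < T i j
      row i j pos with T i (suc j) in eq
      ... | suc k = from (dual (suc k) i j) (ℕ.≤-trans (down-< _ _) (s≤s
              (subst (λ b → r (suc (k + i)) (suc b) ≤ k) (ℕ.+-suc k j)
                (to (dual k i (suc j)) (ℕ.≤-reflexive (sym eq))))))
      col : ∀ i j → 0 < T (suc i) j → T (suc i) j < T i j
      col i j pos with T (suc i) j in eq
      ... | suc k = from (dual (suc k) i j) (ℕ.≤-trans (right-< _ _) (s≤s
              (subst (λ a → r (suc a) (suc (k + j)) ≤ k) (ℕ.+-suc k i)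
                (to (dual k (suc i) j) (ℕ.≤-reflexive (sym eq))))))
      bound : ∀ i j → T i j ≤ m
      bound i j with T i j in eq
      ... | zero  = z≤n
      ... | suc k = ℕ.≤-trans (s≤s (ℕ.m≤m+n k i)) (ℕ.≤-pred
              (proj₁ (within k i j (to (dual k i j) (ℕ.≤-reflexive (sym eq))))))

-- Inequalities in a tableau and the height function it defines

module Tableau {m : ℕ} {T : ℕ → ℕ → ℕ} (t : IsTableau m T) where
  open IsTableau t

  -- Each step right or down raises the coordinate sum by 1 and lowers the entry by at least 1.
  -- Positivity at the far end propagates backwards, so every step on the way is strict.
  descent : ∀ {i i′ j j′} → i ≤ i′ → j ≤ j′ → 0 < T i′ j′ → T i′ j′ + (i′ + j′) ≤ T i j + (i + j)
  descent {i} {i′} {j} {j′} i≤ j≤ pos = go (ℕ.≤⇒≤′ i≤) (ℕ.≤⇒≤′ j≤) pos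
    where
    go : ∀ {i i′ j j′} → i ≤′ i′ → j ≤′ j′ → 0 < T i′ j′ → T i′ j′ + (i′ + j′) ≤ T i j + (i + j)
    go (≤′-reflexive refl) (≤′-reflexive refl) pos = ℕ.≤-refl
    go {i} {i′} {j} (≤′-reflexive refl) (≤′-step {j′} q) pos = begin
      T i (suc j′) + (i + suc j′)   ≡⟨ cong (T i (suc j′) +_) (ℕ.+-suc i j′) ⟩
      T i (suc j′) + suc (i + j′)   ≡⟨ ℕ.+-suc _ _ ⟩
      suc (T i (suc j′)) + (i + j′) ≤⟨ ℕ.+-monoˡ-≤ (i + j′) (row i j′ pos) ⟩
      T i j′ + (i + j′)             ≤⟨ go (≤′-reflexive refl) q (ℕ.≤-<-trans z≤n (row i j′ pos)) ⟩
      T i j + (i + j)               ∎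
      where open ℕ.≤-Reasoning
    go {i} {j = j} {j′} (≤′-step {i′} p) q pos = begin
      T (suc i′) j′ + suc (i′ + j′) ≡⟨ ℕ.+-suc _ _ ⟩
      suc (T (suc i′) j′) + (i′ + j′) ≤⟨ ℕ.+-monoˡ-≤ (i′ + j′) (col i′ j′ pos) ⟩
      T i′ j′ + (i′ + j′)           ≤⟨ go p q (ℕ.≤-<-trans z≤n (col i′ j′ pos)) ⟩
      T i j + (i + j)               ∎
      where open ℕ.≤-Reasoning

  -- Climbing the column raises the entry at every step, up to at most m in the top row. This keeps
  -- the crossing paired with a cell inside the grid.
  row-bound : ∀ i j → 0 < T i j → T i j + i ≤ m
  row-bound zero    j pos = ℕ.≤-trans (ℕ.≤-reflexive (ℕ.+-identityʳ _)) (bound 0 j)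
  row-bound (suc i) j pos = begin
    T (suc i) j + suc i   ≡⟨ ℕ.+-suc _ i ⟩
    suc (T (suc i) j) + i ≤⟨ ℕ.+-monoˡ-≤ i (col i j pos) ⟩
    T i j + i             ≤⟨ row-bound i j (ℕ.≤-<-trans z≤n (col i j pos)) ⟩
    m                     ∎
    where open ℕ.≤-Reasoning

-- Starting from k = 0, the search goes up the diagonal for the least k such that the cell k + 1
-- steps northwest of the vertex (a, b) has entry above k. If there is none it ends with the smaller
-- coordinate. Duality forces this to be the height.
low : (ℕ → ℕ → ℕ) → ℕ → ℕ → ℕ → ℕ
low T k zero    b       = k
low T k (suc a) zero    = k
low T k (suc a) (suc b) with k <? T a b
... | yes _ = k
... | no  _ = low T (suc k) a b

heightOf : (ℕ → ℕ → ℕ) → ℕ → ℕ → ℕ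
heightOf T = low T 0

low-≥ : ∀ T k a b → k ≤ low T k a b
low-≥ T k zero    b       = ℕ.≤-refl
low-≥ T k (suc a) zero    = ℕ.≤-refl
low-≥ T k (suc a) (suc b) with k <? T a b
... | yes _ = ℕ.≤-refl
... | no  _ = ℕ.<⇒≤ (low-≥ T (suc k) a b)

low-≤-row : ∀ T k a b → low T k a b ≤ k + a
low-≤-row T k zero    b       = ℕ.m≤m+n k 0
low-≤-row T k (suc a) zero    = ℕ.m≤m+n k (suc a)
low-≤-row T k (suc a) (suc b) with k <? T a b
... | yes _ = ℕ.m≤m+n k (suc a)
... | no  _ = ℕ.≤-trans (low-≤-row T (suc k) a b) (ℕ.≤-reflexive (sym (ℕ.+-suc k a)))

low-≤-col : ∀ T k a b → low T k a b ≤ k + b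
low-≤-col T k zero    b       = ℕ.m≤m+n k b
low-≤-col T k (suc a) zero    = ℕ.m≤m+n k 0
low-≤-col T k (suc a) (suc b) with k <? T a b
... | yes _ = ℕ.m≤m+n k (suc b)
... | no  _ = ℕ.≤-trans (low-≤-col T (suc k) a b) (ℕ.≤-reflexive (sym (ℕ.+-suc k b)))

module _ {m : ℕ} {T : ℕ → ℕ → ℕ} (t : IsTableau m T) where
  open IsTableau t
  open Tableau t

  diag-descent : ∀ c k i j → k < T (c + i) (c + j) → k + c < T i j
  diag-descent c k i j p = ℕ.+-cancelʳ-≤ (i + j) _ _ (begin
    suc (k + c) + (i + j)               ≤⟨ ℕ.+-monoˡ-≤ (i + j) (ℕ.+-monoˡ-≤ c p) ⟩
    -- A diagonal step contains two descents, so a surplus of c is given away here.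
    T (c + i) (c + j) + c + (i + j)     ≤⟨ ℕ.m≤m+n _ c ⟩
    T (c + i) (c + j) + c + (i + j) + c ≡⟨ rearrange (T (c + i) (c + j)) c i j ⟩
    T (c + i) (c + j) + (c + i + (c + j)) ≤⟨ descent (ℕ.m≤n+m i c) (ℕ.m≤n+m j c) (ℕ.≤-<-trans z≤n p) ⟩
    T i j + (i + j)                     ∎)
    where
    open ℕ.≤-Reasoning
    rearrange : ∀ x c i j → x + c + (i + j) + c ≡ x + (c + i + (c + j))
    rearrange = solve-∀

  -- Here c counts the diagonal steps left before the search tests (i, j). An earlier success forces
  -- the inequality at (i, j) by `diag-descent`; a failure reduces c by 1.
  low-dual : ∀ c k i j → k + c < T i j ⇔ low T k (suc (c + i)) (suc (c + j)) ≤ k + c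
  low-dual c k i j with k <? T (c + i) (c + j)
  ... | yes p = mk⇔ (λ _ → ℕ.m≤m+n k c) (λ _ → diag-descent c k i j p)
  low-dual zero    k i j | no ¬p rewrite ℕ.+-identityʳ k =
    mk⇔ (⊥-elim ∘ ¬p) (λ q → ⊥-elim (ℕ.n≮n k (ℕ.≤-trans (low-≥ T (suc k) i j) q)))
  low-dual (suc c) k i j | no ¬p rewrite ℕ.+-suc k c = low-dual c (suc k) i j

  heightOf-dual : Dual (heightOf T) T
  heightOf-dual k = low-dual k 0

-- Duality and the coordinate bounds survive transposition, so only horizontal steps are treated
-- here; the vertical ones come from the transposed tableau.
module Height {m : ℕ} {r T : ℕ → ℕ → ℕ} (t : IsTableau m T) (dual : Dual r T)
              (≤-row : ∀ a b → r a b ≤ a) (≤-col : ∀ a b → r a b ≤ b) where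
  open IsTableau t
  open Tableau t

  -- With k the height at the right vertex, duality gives `k < T i (suc j)`. The row decrease passes
  -- this to `T i j`, which bounds the height at the left vertex. In `right-<` a column decrease
  -- instead raises the bound by 1.
  right-≤ : ∀ a b → r a b ≤ r a (suc b)
  right-≤ a b with ≤⊎> (r a (suc b)) a | ≤⊎> (r a (suc b)) b
  ... | inj₁ p | _      = ℕ.≤-trans (≤-row a b) p
  ... | _      | inj₁ q = ℕ.≤-trans (≤-col a b) q
  ... | inj₂ (i , p) | inj₂ (j , q) = subst₂ (λ a b → r a b ≤ k) (sym p) (sym q)
    (to (dual k i j) (ℕ.<-trans k<T (row i j (ℕ.≤-<-trans z≤n k<T))))
    where
    k = r a (suc b)
    k<T : k < T i (suc j)
    k<T = from (dual k i (suc j)) (subst₂ (λ a b → r a b ≤ k) p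
      (trans (cong suc q) (cong suc (sym (ℕ.+-suc k j)))) ℕ.≤-refl)

  right-< : ∀ a b → r a (suc b) ≤ suc (r a b)
  right-< a b with ≤⊎> (r a b) a | ≤⊎> (r a b) b
  ... | inj₁ p | _      = ℕ.≤-trans (≤-row a (suc b)) (ℕ.m≤n⇒m≤1+n p)
  ... | _      | inj₁ q = ℕ.≤-trans (≤-col a (suc b)) (s≤s q)
  -- There is no entry above row 0, but then a is k + 1 and the coordinate bound suffices.
  ... | inj₂ (zero , p) | _ = ℕ.≤-trans (≤-row a (suc b))
    (ℕ.≤-reflexive (trans p (cong suc (ℕ.+-identityʳ _))))
  ... | inj₂ (suc i , p) | inj₂ (j , q) = subst₂ (λ a b → r a b ≤ suc k)
    (sym (trans p (cong suc (ℕ.+-suc k i)))) (cong suc (sym q))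
    (to (dual (suc k) i j) (ℕ.≤-<-trans k<T (col i j (ℕ.≤-<-trans z≤n k<T))))
    where
    k = r a b
    k<T : k < T (suc i) j
    k<T = from (dual k (suc i) j) (subst₂ (λ a b → r a b ≤ k) p q ℕ.≤-refl)

  -- A positive height k + 1 at the southeast vertex certifies an entry above k + 1. The same entry
  -- is above k, which bounds the height at the northwest vertex by k.
  hecke : ∀ a b → r (suc a) (suc b) ≡ r a b → r (suc a) (suc b) ≡ 0
  hecke a b eq with r (suc a) (suc b) in eq′
  ... | zero  = refl
  ... | suc k = ⊥-elim (ℕ.n≮n k (subst (_≤ k) (sym eq) r≤k))
    where
    r≤k : r a b ≤ k
    r≤k with ≤⊎> k a | ≤⊎> k b
    ... | inj₁ p | _      = ℕ.≤-trans (≤-row a b) p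
    ... | _      | inj₁ q = ℕ.≤-trans (≤-col a b) q
    ... | inj₂ (i , refl) | inj₂ (j , refl) =
      to (dual k i j) (ℕ.<⇒≤ (from (dual (suc k) i j) (ℕ.≤-reflexive eq′)))

  outside : ∀ a b → suc m ≤ a ⊎ suc m ≤ b → r a b ≡ a ⊓ b
  outside a b out = ℕ.≤-antisym (ℕ.⊓-glb (≤-row a b) (≤-col a b)) (min≤ (r a b) refl out)
    where
    min≤ : ∀ k → r a b ≡ k → suc m ≤ a ⊎ suc m ≤ b → a ⊓ b ≤ k
    min≤ k eq out with ≤⊎> k a | ≤⊎> k b
    ... | inj₁ p | _      = ℕ.≤-trans (ℕ.m⊓n≤m a b) p
    ... | _      | inj₁ q = ℕ.≤-trans (ℕ.m⊓n≤n a b) q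
    ... | inj₂ (i , refl) | inj₂ (j , refl) = ⊥-elim (absurd out)
      where
      k<T : k < T i j
      k<T = from (dual k i j) (ℕ.≤-reflexive eq)
      pos = ℕ.≤-<-trans z≤n k<T
      -- An entry above k in row i needs k + 1 + i at most m by `row-bound`; transposition gives the
      -- same for columns.
      absurd : ¬ (suc m ≤ suc (k + i) ⊎ suc m ≤ suc (k + j))
      absurd (inj₁ (s≤s q)) = ℕ.n≮n (k + i)
        (ℕ.≤-trans (ℕ.≤-trans (ℕ.+-monoˡ-≤ i k<T) (row-bound i j pos)) q)
      absurd (inj₂ (s≤s q)) = ℕ.n≮n (k + j)
        (ℕ.≤-trans (ℕ.≤-trans (ℕ.+-monoˡ-≤ j k<T) (Tableau.row-bound (transposed t) j i pos)) q)

module _ {m : ℕ} {T : ℕ → ℕ → ℕ} (t : IsTableau m T) where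

  heightOf-isHeight : IsHeight (suc m) (heightOf T)
  heightOf-isHeight = record
    { top-0   = λ b → refl
    ; left-0  = λ { zero → refl ; (suc a) → refl }
    ; right-≤ = H.right-≤
    ; right-< = H.right-<
    ; down-≤  = flip Hᵗ.right-≤
    ; down-<  = flip Hᵗ.right-<
    ; outside = H.outside
    ; hecke   = H.hecke
    }
    where
    dual = heightOf-dual t
    module H = Height t dual (low-≤-row T 0) (low-≤-col T 0)
    module Hᵗ = Height {r = flip (heightOf T)} (transposed t) (λ k → flip (dual k))
      (flip (low-≤-col T 0)) (flip (low-≤-row T 0))

-- With k the value of `r` at the vertex, duality transports the bound to `r′` if both coordinates
-- exceed k. If one does not, that coordinate already bounds `r′`.
dual-≤ : ∀ {n n′ r r′ T T′} → IsHeight n r → IsHeight n′ r′ → Dual r T → Dual r′ T′ →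
         (∀ i j → T i j ≡ T′ i j) → ∀ a b → r′ a b ≤ r a b
dual-≤ {r = r} {r′} h h′ d d′ T≡ a b with ≤⊎> (r a b) a | ≤⊎> (r a b) b
... | inj₁ p | _      = ℕ.≤-trans (IsHeight.≤-row h′ a b) p
... | _      | inj₁ q = ℕ.≤-trans (IsHeight.≤-col h′ a b) q
... | inj₂ (i , p) | inj₂ (j , q) = subst₂ (λ a b → r′ a b ≤ k) (sym p) (sym q)
  (to (d′ k i j) (subst (k <_) (T≡ i j) (from (d k i j) (subst₂ (λ a b → r a b ≤ k) p q ℕ.≤-refl))))
  where k = r a b

dual-injective : ∀ {n n′ r r′ T T′} → IsHeight n r → IsHeight n′ r′ → Dual r T → Dual r′ T′ →
                 (∀ i j → T i j ≡ T′ i j) → ∀ a b → r a b ≡ r′ a b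
dual-injective h h′ d d′ T≡ a b =
  ℕ.≤-antisym (dual-≤ h′ h d′ d (λ i j → sym (T≡ i j)) a b) (dual-≤ h h′ d d′ T≡ a b)

dual-functional : ∀ {r r′ T T′} → Dual r T → Dual r′ T′ → (∀ a b → r a b ≡ r′ a b) →
                  ∀ i j → T i j ≡ T′ i j
dual-functional d d′ r≡ i j =
  ℕ.≤-antisym (<⇒≤ λ k → from (d′ k i j) ∘ subst (_≤ k) (r≡ _ _) ∘ to (d k i j))
              (<⇒≤ λ k → from (d k i j) ∘ subst (_≤ k) (sym (r≡ _ _)) ∘ to (d′ k i j))
  where
  <⇒≤ : ∀ {x y} → (∀ k → k < x → k < y) → x ≤ y
  <⇒≤ {zero}  f = z≤n
  <⇒≤ {suc x} f = f x ℕ.≤-refl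

-- Cell (i , j , k) stands for the blank (i , j) of value k + 1, whose crossing is
-- at (k + i + 1 , k + j + 1).
Triple : Set
Triple = ℕ × ℕ × ℕ

-- The column reading order of the blanks, and the order in which a sweep from the bottom row up,
-- left to right, meets their crossings. The common summand 1 in the coordinates of the crossings is
-- dropped.
ColumnOrder RowOrder : Triple → Triple → Set
ColumnOrder (i , j , _) (i′ , j′ , _) = j < j′ ⊎ j ≡ j′ × i′ < i
RowOrder (i , j , k) (i′ , j′ , k′) = i′ + k′ < i + k ⊎ i′ + k′ ≡ i + k × j + k < j′ + k′

shift-far : ∀ {i i′ k k′} → i′ < i → i + k < i′ + k′ → 2 + k ≤ k′
shift-far {i} {i′} {k} {k′} p q = ℕ.+-cancelˡ-≤ i′ _ _ (begin
  i′ + (2 + k)     ≡⟨ ℕ.+-suc i′ (suc k) ⟩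
  suc (i′ + suc k) ≡⟨ cong suc (ℕ.+-suc i′ k) ⟩
  suc (suc i′ + k) ≤⟨ s≤s (ℕ.+-monoˡ-≤ k p) ⟩
  suc (i + k)      ≤⟨ q ⟩
  i′ + k′          ∎)
  where open ℕ.≤-Reasoning

-- A disagreement of the orders is a pair of opposite strict inequalities, before and after shifting
-- by k and k′. Together they separate k and k′ by at least 2.
orders-far : ∀ {m T} → IsTableau m T → ∀ {i j k i′ j′ k′} → T i j ≡ suc k → T i′ j′ ≡ suc k′ →
             ColumnOrder (i , j , k) (i′ , j′ , k′) → RowOrder (i′ , j′ , k′) (i , j , k) → Far k′ k
orders-far t _ _ (inj₁ j<) (inj₂ (_ , q)) = inj₁ (shift-far j< q)
orders-far t _ _ (inj₂ (refl , i<)) (inj₁ p) = inj₂ (shift-far i< p)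
orders-far t {i = i} {j} {k} {i′} {k′ = k′} _ _ (inj₂ (refl , i<)) (inj₂ (p , q)) =
  ⊥-elim (ℕ.<-irrefl (sym p) (ℕ.+-mono-< i< (ℕ.+-cancelˡ-< j k′ k q)))
orders-far {T = T} t {i} {j} {k} {i′} {j′} {k′} eq eq′ (inj₁ j<) (inj₁ p) with i′ <? i
... | yes i< = inj₂ (shift-far i< p)
-- Now the second blank lies weakly southeast of the first, and `descent` contradicts its crossing
-- being lower.
... | no i≮  = ⊥-elim (ℕ.n≮n (k + (i + j)) (begin-strict
  k + (i + j)      ≡⟨ r₁ k i j ⟩
  i + k + j        <⟨ ℕ.+-mono-< p j< ⟩
  i′ + k′ + j′     ≡⟨ r₁ k′ i′ j′ ⟨
  k′ + (i′ + j′)   ≤⟨ ℕ.≤-pred (subst₂ (λ x y → x + (i′ + j′) ≤ y + (i + j)) eq′ eq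
                        (Tableau.descent t (ℕ.≮⇒≥ i≮) (ℕ.<⇒≤ j<)
                          (subst (0 <_) (sym eq′) (s≤s z≤n)))) ⟩
  k + (i + j)      ∎))
  where
  open ℕ.≤-Reasoning
  r₁ : ∀ k i j → k + (i + j) ≡ i + k + j
  r₁ = solve-∀

-- Heights of bumpless pipe dreams

nth-suc-≤ : ∀ {xs} → Linked _≥_ xs → ∀ i → nth xs (suc i) ≤ nth xs i
nth-suc-≤ []       i       = z≤n
nth-suc-≤ [-]      i       = z≤n
nth-suc-≤ (p ∷ ps) zero    = p
nth-suc-≤ (p ∷ ps) (suc i) = nth-suc-≤ ps i

!-antitone : ∀ ƛ {i i′} → i ≤ i′ → ƛ ! i′ ≤ ƛ ! i
!-antitone ƛ {i} i≤i′ = go (ℕ.≤⇒≤′ i≤i′)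
  where
  go : ∀ {i′} → i ≤′ i′ → ƛ ! i′ ≤ ƛ ! i
  go ≤′-refl           = ℕ.≤-refl
  go (≤′-step {i′} p)  = ℕ.≤-trans (nth-suc-≤ (decreasing ƛ) i′) (go p)

𝕐-lower : ∀ ƛ {i i′ j j′} → i ≤ i′ → j ≤ j′ → (i′ , j′) ∈ 𝕐 ƛ → (i , j) ∈ 𝕐 ƛ
𝕐-lower ƛ i≤ j≤ p = ℕ.≤-<-trans j≤ (ℕ.<-≤-trans p (!-antitone ƛ i≤))

-- Positive parts are distinguishable from the default 0, so `nth` also detects the length.
nth-injective : ∀ {xs ys} → All (_> 0) xs → All (_> 0) ys → (∀ i → nth xs i ≡ nth ys i) → xs ≡ ys
nth-injective []       []       eq = refl
nth-injective []       (q ∷ qs) eq = ⊥-elim (ℕ.<⇒≢ q (eq 0))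
nth-injective (p ∷ ps) []       eq = ⊥-elim (ℕ.<⇒≢ p (sym (eq 0)))
nth-injective (p ∷ ps) (q ∷ qs) eq = cong₂ _∷_ (eq 0) (nth-injective ps qs (eq ∘ suc))

𝕐-injective : ∀ {ƛ μ} → 𝕐 ƛ ≐ 𝕐 μ → ƛ ≈ᵖ μ
𝕐-injective {ƛ} {μ} (λ⊆μ , μ⊆λ) = nth-injective (positive ƛ) (positive μ) λ i →
  ℕ.≤-antisym (below λ j → λ⊆μ {i , j}) (below λ j → μ⊆λ {i , j})
  where
  below : ∀ {x y} → (∀ j → j < x → j < y) → x ≤ y
  below {zero}  f = z≤n
  below {suc x} f = f x ℕ.≤-refl

-- Pipes at the edges of a tile

β : Bool → ℕ
β false = 0
β true  = 1

β-injective : ∀ {x y} → β x ≡ β y → x ≡ y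
β-injective {false} {false} _ = refl
β-injective {true}  {true}  _ = refl

β-≤1 : ∀ x → β x ≤ 1
β-≤1 false = z≤n
β-≤1 true  = ℕ.≤-refl

-- Every pipe of a tile enters through the left or bottom edge and leaves through the top or right
-- edge.
tile-balance : ∀ t → β (top t) + β (right t) ≡ β (left t) + β (bottom t)
tile-balance downElbow  = refl
tile-balance upElbow    = refl
tile-balance crossing   = refl
tile-balance blank      = refl
tile-balance horizontal = refl
tile-balance vertical   = refl

-- Three edges determine a tile, the fourth being fixed by the balance. In the wildcard clauses the
-- balance also forces the right edge.
tileOf : (l t r : Bool) → Tile
tileOf true  true  true  = crossing
tileOf true  true  false = upElbow
tileOf true  false _     = horizontal
tileOf false true  _     = vertical
tileOf false false true  = downElbow
tileOf false false false = blank

tileOf-edges : ∀ t → tileOf (left t) (top t) (right t) ≡ t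
tileOf-edges downElbow  = refl
tileOf-edges upElbow    = refl
tileOf-edges crossing   = refl
tileOf-edges blank      = refl
tileOf-edges horizontal = refl
tileOf-edges vertical   = refl

edges-tileOf : ∀ l t r b → β t + β r ≡ β l + β b →
               left (tileOf l t r) ≡ l × top (tileOf l t r) ≡ t ×
               right (tileOf l t r) ≡ r × bottom (tileOf l t r) ≡ b
edges-tileOf true  true  true  true  _ = refl , refl , refl , refl
edges-tileOf true  true  false false _ = refl , refl , refl , refl
edges-tileOf true  false true  false _ = refl , refl , refl , refl
edges-tileOf false true  false true  _ = refl , refl , refl , refl
edges-tileOf false false true  true  _ = refl , refl , refl , refl
edges-tileOf false false false false _ = refl , refl , refl , refl

-- The tiles continuing every bumpless pipe dream beyond its right and bottom
-- boundaries.
outer : ℕ → ℕ → Tile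
outer zero    zero    = downElbow
outer zero    (suc b) = horizontal
outer (suc a) zero    = vertical
outer (suc a) (suc b) = outer a b

outer-horizontal : ∀ {a b} → a < b → outer a b ≡ horizontal
outer-horizontal {zero}  {suc b} _       = refl
outer-horizontal {suc a} {suc b} (s≤s p) = outer-horizontal p

outer-vertical : ∀ {a b} → b < a → outer a b ≡ vertical
outer-vertical {suc a} {zero}  _       = refl
outer-vertical {suc a} {suc b} (s≤s p) = outer-vertical p

outer-≢blank : ∀ a b → ¬ outer a b ≡ blank
outer-≢blank zero    zero    ()
outer-≢blank zero    (suc b) ()
outer-≢blank (suc a) zero    ()
outer-≢blank (suc a) (suc b) = outer-≢blank a b

outer-match-horizontal : ∀ a b → right (outer a b) ≡ left (outer a (suc b))
outer-match-horizontal zero          zero    = refl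
outer-match-horizontal zero          (suc b) = refl
outer-match-horizontal (suc zero)    zero    = refl
outer-match-horizontal (suc (suc a)) zero    = refl
outer-match-horizontal (suc a)       (suc b) = outer-match-horizontal a b

outer-match-vertical : ∀ a b → bottom (outer a b) ≡ top (outer (suc a) b)
outer-match-vertical zero    zero          = refl
outer-match-vertical (suc a) zero          = refl
outer-match-vertical zero    (suc zero)    = refl
outer-match-vertical zero    (suc (suc b)) = refl
outer-match-vertical (suc a) (suc b)       = outer-match-vertical a b

⊓-outer-top : ∀ a b → a ⊓ suc b ≡ a ⊓ b + β (top (outer a b))
⊓-outer-top zero    zero    = refl
⊓-outer-top zero    (suc b) = refl
⊓-outer-top (suc a) zero    = cong suc (ℕ.⊓-zeroʳ a)
⊓-outer-top (suc a) (suc b) = cong suc (⊓-outer-top a b)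

⊓-outer-left : ∀ a b → suc a ⊓ b ≡ a ⊓ b + β (left (outer a b))
⊓-outer-left zero    zero    = refl
⊓-outer-left (suc a) zero    = refl
⊓-outer-left zero    (suc b) = refl
⊓-outer-left (suc a) (suc b) = cong suc (⊓-outer-left a b)

-- Tilings of the quarter plane and their heights

module _ {n : ℕ} (t : Tiling n) where

  extend : ℕ → ℕ → Tile
  extend a b with a <? n | b <? n
  ... | yes p | yes q = t at (fromℕ< p , fromℕ< q)
  ... | _     | _     = outer a b

  extend-inner : ∀ i j → extend (toℕ i) (toℕ j) ≡ t at (i , j)
  extend-inner i j with toℕ i <? n | toℕ j <? n
  ... | yes p | yes q = cong₂ (λ i j → t at (i , j)) (Fin.fromℕ<-toℕ i p) (Fin.fromℕ<-toℕ j q)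
  ... | no ¬p | _     = ⊥-elim (¬p (Fin.toℕ<n i))
  ... | yes _ | no ¬q = ⊥-elim (¬q (Fin.toℕ<n j))

  extend-< : ∀ {a b} (p : a < n) (q : b < n) → extend a b ≡ t at (fromℕ< p , fromℕ< q)
  extend-< p q = trans (sym (cong₂ extend (Fin.toℕ-fromℕ< p) (Fin.toℕ-fromℕ< q)))
                       (extend-inner (fromℕ< p) (fromℕ< q))

  extend-outer : ∀ a b → n ≤ a ⊎ n ≤ b → extend a b ≡ outer a b
  extend-outer a b out with a <? n | b <? n | out
  ... | yes p | yes q | inj₁ n≤a = ⊥-elim (ℕ.<⇒≱ p n≤a)
  ... | yes p | yes q | inj₂ n≤b = ⊥-elim (ℕ.<⇒≱ q n≤b)
  ... | no _  | _     | _        = refl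
  ... | yes _ | no _  | _        = refl

  extend-inner⁻¹ : ∀ {x} a b → extend a b ≡ x → ¬ outer a b ≡ x →
                   ∃₂ λ i j → toℕ i ≡ a × toℕ j ≡ b × t at (i , j) ≡ x
  extend-inner⁻¹ a b eq ≢ with a <? n | b <? n
  ... | yes p | yes q = fromℕ< p , fromℕ< q , Fin.toℕ-fromℕ< p , Fin.toℕ-fromℕ< q , eq
  ... | no _  | _     = ⊥-elim (≢ eq)
  ... | yes _ | no _  = ⊥-elim (≢ eq)

-- r a b counts the pipes of τ passing northwest of the vertex between row a - 1
-- and row a, column b - 1 and column b.
record Counts (τ : ℕ → ℕ → Tile) (r : ℕ → ℕ → ℕ) : Set where
  field
    top-edge    : ∀ a b → r a (suc b) ≡ r a b + β (top (τ a b))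
    left-edge   : ∀ a b → r (suc a) b ≡ r a b + β (left (τ a b))
    bottom-edge : ∀ a b → r (suc a) (suc b) ≡ r (suc a) b + β (bottom (τ a b))
    right-edge  : ∀ a b → r (suc a) (suc b) ≡ r a (suc b) + β (right (τ a b))

  diagonal-edges : ∀ a b → r (suc a) (suc b) ≡ r a b + (β (left (τ a b)) + β (bottom (τ a b)))
  diagonal-edges a b = trans (bottom-edge a b) (trans (cong (_+ _) (left-edge a b)) (ℕ.+-assoc (r a b) _ _))

-- Differences of heights recover the edges of each cell, and three edges recover its tile.
Counts-unique : ∀ {τ τ′ r r′} → Counts τ r → Counts τ′ r′ → (∀ a b → r a b ≡ r′ a b) →
                ∀ a b → τ a b ≡ τ′ a b
Counts-unique {τ} {τ′} {r} {r′} c c′ r≡ a b = begin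
  τ a b   ≡⟨ tileOf-edges (τ a b) ⟨
  tileOf (left (τ a b)) (top (τ a b)) (right (τ a b))
    ≡⟨ cong₂ (λ l (t , r) → tileOf l t r) (edge (Cτ.left-edge a b) (Cτ′.left-edge a b) )
         (cong₂ _,_ (edge (Cτ.top-edge a b) (Cτ′.top-edge a b)) (edge (Cτ.right-edge a b) (Cτ′.right-edge a b))) ⟩
  tileOf (left (τ′ a b)) (top (τ′ a b)) (right (τ′ a b)) ≡⟨ tileOf-edges (τ′ a b) ⟩
  τ′ a b  ∎
  where
  open ≡-Reasoning
  module Cτ = Counts c
  module Cτ′ = Counts c′
  edge : ∀ {a b a′ b′ x y} → r a′ b′ ≡ r a b + β x → r′ a′ b′ ≡ r′ a b + β y → x ≡ y
  edge {a} {b} {a′} {b′} {x} {y} p q = β-injective (ℕ.+-cancelˡ-≡ (r a b) _ _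
    (trans (sym p) (trans (r≡ a′ b′) (trans q (cong (_+ β y) (sym (r≡ a b)))))))

module _ {n : ℕ} (P : BPD n) where
  open BPD P using (match-horizontal; match-vertical; left-boundary; top-boundary; right-boundary; bottom-boundary)

  tiles : ℕ → ℕ → Tile
  tiles = extend (tiling P)

  -- A pipe passing northwest of (a, b) crosses the vertical line at b exactly once, in a row above
  -- a. The recursion counts these crossings of the line.
  height : ℕ → ℕ → ℕ
  height zero    b = 0
  height (suc a) b = height a b + β (left (tiles a b))

  tiles-horizontal : ∀ a b → right (tiles a b) ≡ left (tiles a (suc b))
  tiles-horizontal a b = go (a <? n) (suc b <? n)
    where
    both-outer : n ≤ a ⊎ n ≤ b → right (tiles a b) ≡ left (tiles a (suc b))
    both-outer p = trans (cong right (extend-outer (tiling P) a b p))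
      (trans (outer-match-horizontal a b)
        (sym (cong left (extend-outer (tiling P) a (suc b) (map₂ ℕ.m≤n⇒m≤1+n p)))))
    go : Dec (a < n) → Dec (suc b < n) → right (tiles a b) ≡ left (tiles a (suc b))
    go (no a≮n)  _          = both-outer (inj₁ (ℕ.≮⇒≥ a≮n))
    go (yes a<n) (yes sb<n) = trans (cong right (extend-< (tiling P) a<n (ℕ.<⇒≤ sb<n)))
      (trans (match-horizontal _ (trans (Fin.toℕ-fromℕ< sb<n) (cong suc (sym (Fin.toℕ-fromℕ< (ℕ.<⇒≤ sb<n))))))
        (sym (cong left (extend-< (tiling P) a<n sb<n))))
    go (yes a<n) (no sb≮n) with ℕ.m≤n⇒m<n∨m≡n (ℕ.≮⇒≥ sb≮n)
    ... | inj₁ (s≤s n≤b) = both-outer (inj₂ n≤b)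
    -- At the right boundary every row emits a pipe, and the first outer tile of a row a < n is
    -- horizontal.
    ... | inj₂ n≡sb = trans (cong right (extend-< (tiling P) a<n b<n))
      (trans (right-boundary _ _ (trans (cong suc (Fin.toℕ-fromℕ< b<n)) (sym n≡sb)))
        (sym (cong left (trans (extend-outer (tiling P) a (suc b) (inj₂ (ℕ.≤-reflexive n≡sb)))
          (outer-horizontal (subst (a <_) n≡sb a<n))))))
      where b<n = ℕ.≤-reflexive (sym n≡sb)

  tiles-vertical : ∀ a b → bottom (tiles a b) ≡ top (tiles (suc a) b)
  tiles-vertical a b = go (suc a <? n) (b <? n)
    where
    both-outer : n ≤ a ⊎ n ≤ b → bottom (tiles a b) ≡ top (tiles (suc a) b)
    both-outer p = trans (cong bottom (extend-outer (tiling P) a b p))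
      (trans (outer-match-vertical a b)
        (sym (cong top (extend-outer (tiling P) (suc a) b (map₁ ℕ.m≤n⇒m≤1+n p)))))
    go : Dec (suc a < n) → Dec (b < n) → bottom (tiles a b) ≡ top (tiles (suc a) b)
    go _          (no b≮n)  = both-outer (inj₂ (ℕ.≮⇒≥ b≮n))
    go (yes sa<n) (yes b<n) = trans (cong bottom (extend-< (tiling P) (ℕ.<⇒≤ sa<n) b<n))
      (trans (match-vertical _ (trans (Fin.toℕ-fromℕ< sa<n) (cong suc (sym (Fin.toℕ-fromℕ< (ℕ.<⇒≤ sa<n))))))
        (sym (cong top (extend-< (tiling P) sa<n b<n))))
    go (no sa≮n) (yes b<n) with ℕ.m≤n⇒m<n∨m≡n (ℕ.≮⇒≥ sa≮n)
    ... | inj₁ (s≤s n≤a) = both-outer (inj₁ n≤a)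
    ... | inj₂ n≡sa = trans (cong bottom (extend-< (tiling P) a<n b<n))
      (trans (bottom-boundary _ _ (trans (cong suc (Fin.toℕ-fromℕ< a<n)) (sym n≡sa)))
        (sym (cong top (trans (extend-outer (tiling P) (suc a) b (inj₁ (ℕ.≤-reflexive n≡sa)))
          (outer-vertical (subst (b <_) n≡sa b<n))))))
      where a<n = ℕ.≤-reflexive (sym n≡sa)

  tiles-left : ∀ a → left (tiles a 0) ≡ false
  tiles-left a with a <? n | 0 <? n
  ... | yes p | yes q = left-boundary _ _ (Fin.toℕ-fromℕ< q)
  ... | yes p | no ¬q = ⊥-elim (¬q (ℕ.≤-<-trans z≤n p))
  ... | no ¬p | _ with a
  ...   | zero  = refl
  ...   | suc _ = refl

  tiles-top : ∀ b → top (tiles 0 b) ≡ false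
  tiles-top b with 0 <? n | b <? n
  ... | yes p | yes q = top-boundary _ _ (Fin.toℕ-fromℕ< p)
  ... | no ¬p | yes q = ⊥-elim (¬p (ℕ.≤-<-trans z≤n q))
  ... | no _  | no _ with b
  ...   | zero  = refl
  ...   | suc _ = refl
  tiles-top b | yes _ | no _ with b
  ...   | zero  = refl
  ...   | suc _ = refl

  -- By `tile-balance` the two ways around a cell give the same increment. An induction on rows,
  -- alternating between top and bottom edges, then shows that heights defined by left edges count
  -- the other edges too.
  height-counts : Counts tiles height
  height-counts = record
    { top-edge = top-edge ; left-edge = λ a b → refl ; bottom-edge = bottom-edge
    ; right-edge = λ a b → cong (λ x → height a (suc b) + β x) (sym (tiles-horizontal a b)) }
    where
    open ≡-Reasoning
    top-edge : ∀ a b → height a (suc b) ≡ height a b + β (top (tiles a b))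
    bottom-edge : ∀ a b → height (suc a) (suc b) ≡ height (suc a) b + β (bottom (tiles a b))
    top-edge zero    b = sym (cong β (tiles-top b))
    top-edge (suc a) b = trans (bottom-edge a b) (cong (λ x → height (suc a) b + β x) (tiles-vertical a b))
    bottom-edge a b = let t = tiles a b in begin
      height a (suc b) + β (left (tiles a (suc b)))
        ≡⟨ cong₂ (λ x y → x + β y) (top-edge a b) (sym (tiles-horizontal a b)) ⟩
      height a b + β (top t) + β (right t)             ≡⟨ ℕ.+-assoc (height a b) _ _ ⟩
      height a b + (β (top t) + β (right t))           ≡⟨ cong (height a b +_) (tile-balance t) ⟩
      height a b + (β (left t) + β (bottom t))         ≡⟨ ℕ.+-assoc (height a b) _ _ ⟨
      height a b + β (left t) + β (bottom t)           ∎

  private module Ct = Counts height-counts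

  height-col-0 : ∀ a → height a 0 ≡ 0
  height-col-0 zero    = refl
  height-col-0 (suc a) = cong₂ _+_ (height-col-0 a) (cong β (tiles-left a))

  height-outer : ∀ a b → n ≤ a ⊎ n ≤ b → height a b ≡ a ⊓ b
  height-outer a zero    (inj₁ p) = trans (height-col-0 a) (sym (ℕ.⊓-zeroʳ a))
  height-outer a (suc b) (inj₁ p) = begin
    height a (suc b)                   ≡⟨ Ct.top-edge a b ⟩
    height a b + β (top (tiles a b))   ≡⟨ cong₂ (λ x y → x + β (top y)) (height-outer a b (inj₁ p))
                                            (extend-outer (tiling P) a b (inj₁ p)) ⟩
    a ⊓ b + β (top (outer a b))        ≡⟨ ⊓-outer-top a b ⟨
    a ⊓ suc b                          ∎
    where open ≡-Reasoning
  height-outer zero    b (inj₂ p) = refl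
  height-outer (suc a) b (inj₂ p) = trans
    (cong₂ (λ x y → x + β (left y)) (height-outer a b (inj₂ p)) (extend-outer (tiling P) a b (inj₂ p)))
    (sym (⊓-outer-left a b))

  D⇒blank : ∀ {a b} → (a , b) ∈ D P → tiles a b ≡ blank
  D⇒blank (i , j , refl , refl , eq) = trans (extend-inner (tiling P) i j) eq

  blank⇒D : ∀ {a b} → tiles a b ≡ blank → (a , b) ∈ D P
  blank⇒D {a} {b} eq = extend-inner⁻¹ (tiling P) a b eq (outer-≢blank a b)

no-pipe⇒blank : ∀ t → β (left t) + β (bottom t) ≡ 0 → t ≡ blank
no-pipe⇒blank blank _ = refl

two-pipes⇒crossing : ∀ t → 2 ≤ β (left t) + β (bottom t) → t ≡ crossing
two-pipes⇒crossing downElbow  (s≤s ())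
two-pipes⇒crossing upElbow    (s≤s ())
two-pipes⇒crossing crossing   _ = refl
two-pipes⇒crossing horizontal (s≤s ())
two-pipes⇒crossing vertical   (s≤s ())

module _ {n : ℕ} (P : HBPD n) where

  private
    r = height (bpd P)
    τ = tiles (bpd P)
    module Ct = Counts (height-counts (bpd P))
    ƛ = HBPD.shape P

  shape⇒blank : ∀ {i j} → (i , j) ∈ 𝕐 ƛ → τ i j ≡ blank
  shape⇒blank p = D⇒blank (bpd P) (proj₂ (HBPD.D≐shape P) p)

  blank⇒shape : ∀ {i j} → τ i j ≡ blank → (i , j) ∈ 𝕐 ƛ
  blank⇒shape eq = proj₁ (HBPD.D≐shape P) (blank⇒D (bpd P) eq)

  -- All cells above (i, j) in its column are in the shape too, hence blank, so none of the edges
  -- counted carries a pipe.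
  shape⇒height-0 : ∀ {i j} → (i , j) ∈ 𝕐 ƛ → r (suc i) (suc j) ≡ 0
  shape⇒height-0 {i} {j} p = trans (Ct.bottom-edge i j)
    (cong₂ _+_ (column (suc i) ℕ.≤-refl) (cong (β ∘ bottom) (shape⇒blank p)))
    where
    column : ∀ a → a ≤ suc i → r a j ≡ 0
    column zero    _       = refl
    column (suc a) (s≤s q) = cong₂ _+_ (column a (ℕ.m≤n⇒m≤1+n q))
      (cong (β ∘ left) (shape⇒blank (𝕐-lower ƛ q ℕ.≤-refl p)))

  height-isHeight : IsHeight n r
  height-isHeight = record
    { top-0   = λ b → refl
    ; left-0  = height-col-0 (bpd P)
    ; right-≤ = λ a b → subst (r a b ≤_) (sym (Ct.top-edge a b)) (ℕ.m≤m+n _ _)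
    ; right-< = λ a b → subst₂ _≤_ (sym (Ct.top-edge a b)) (ℕ.+-comm _ 1) (ℕ.+-monoʳ-≤ (r a b) (β-≤1 _))
    ; down-≤  = λ a b → ℕ.m≤m+n _ _
    ; down-<  = λ a b → subst (r (suc a) b ≤_) (ℕ.+-comm _ 1) (ℕ.+-monoʳ-≤ (r a b) (β-≤1 _))
    ; outside = height-outer (bpd P)
    ; hecke   = λ a b eq → shape⇒height-0 (blank⇒shape (no-pipe⇒blank (τ a b)
        (ℕ.+-cancelˡ-≡ (r a b) _ _ (trans (sym (Ct.diagonal-edges a b))
          (trans eq (sym (ℕ.+-identityʳ _)))))))
    }

  height-0⇒shape : ∀ {i j} → r (suc i) (suc j) ≡ 0 → (i , j) ∈ 𝕐 ƛ
  height-0⇒shape {i} {j} eq = blank⇒shape (no-pipe⇒blank (τ i j)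
    (ℕ.m+n≡0⇒n≡0 (r i j) (trans (sym (Ct.diagonal-edges i j)) eq)))

-- Reconstruction of a Hecke bumpless pipe dream from its heights

module FromHeight {n : ℕ} {r : ℕ → ℕ → ℕ} (h : IsHeight n r) (ƛ : Partition)
                  (shape⇔ : ∀ i j → (i , j) ∈ 𝕐 ƛ ⇔ r (suc i) (suc j) ≡ 0) where
  open IsHeight h

  private
    edge : ℕ → ℕ → Bool
    edge x y = does (x <? y)

    edge-β : ∀ {x y} → x ≤ y → y ≤ suc x → y ≡ x + β (edge x y)
    edge-β {x} {y} p q with ℕ.m≤n⇒m<n∨m≡n p
    ... | inj₁ x<y rewrite dec-true (x <? y) x<y = trans (ℕ.≤-antisym q x<y) (ℕ.+-comm 1 x)
    ... | inj₂ refl rewrite dec-false (x <? x) (ℕ.n≮n x) = sym (ℕ.+-identityʳ x)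

    l t b rt : ℕ → ℕ → Bool
    l  i j = edge (r i j) (r (suc i) j)
    t  i j = edge (r i j) (r i (suc j))
    b  i j = edge (r (suc i) j) (r (suc i) (suc j))
    rt i j = edge (r i (suc j)) (r (suc i) (suc j))

    l-β : ∀ i j → r (suc i) j ≡ r i j + β (l i j)
    l-β i j = edge-β (down-≤ i j) (down-< i j)
    t-β : ∀ i j → r i (suc j) ≡ r i j + β (t i j)
    t-β i j = edge-β (right-≤ i j) (right-< i j)

    -- Both paths around the cell lead from `r i j` to the same southeast value.
    balance : ∀ i j → β (t i j) + β (rt i j) ≡ β (l i j) + β (b i j)
    balance i j = ℕ.+-cancelˡ-≡ (r i j) _ _ (begin
      r i j + (β (t i j) + β (rt i j)) ≡⟨ ℕ.+-assoc (r i j) _ _ ⟨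
      r i j + β (t i j) + β (rt i j)   ≡⟨ cong (_+ β (rt i j)) (t-β i j) ⟨
      r i (suc j) + β (rt i j)         ≡⟨ edge-β (down-≤ i (suc j)) (down-< i (suc j)) ⟨
      r (suc i) (suc j)                ≡⟨ edge-β (right-≤ (suc i) j) (right-< (suc i) j) ⟩
      r (suc i) j + β (b i j)          ≡⟨ cong (_+ β (b i j)) (l-β i j) ⟩
      r i j + β (l i j) + β (b i j)    ≡⟨ ℕ.+-assoc (r i j) _ _ ⟩
      r i j + (β (l i j) + β (b i j))  ∎)
      where open ≡-Reasoning

  tileAt : ℕ → ℕ → Tile
  tileAt i j = tileOf (l i j) (t i j) (rt i j)

  private
    left≡ : ∀ i j → left (tileAt i j) ≡ l i j
    left≡ i j = proj₁ (edges-tileOf _ _ _ _ (balance i j))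
    top≡ : ∀ i j → top (tileAt i j) ≡ t i j
    top≡ i j = proj₁ (proj₂ (edges-tileOf _ _ _ _ (balance i j)))
    right≡ : ∀ i j → right (tileAt i j) ≡ rt i j
    right≡ i j = proj₁ (proj₂ (proj₂ (edges-tileOf _ _ _ _ (balance i j))))
    bottom≡ : ∀ i j → bottom (tileAt i j) ≡ b i j
    bottom≡ i j = proj₂ (proj₂ (proj₂ (edges-tileOf _ _ _ _ (balance i j))))

    edge-≡ : ∀ {x y} → x ≡ y → edge x y ≡ false
    edge-≡ {x} refl = dec-false (x <? x) (ℕ.n≮n x)
    edge-suc : ∀ {x y z} → x ≡ z → y ≡ suc z → edge x y ≡ true
    edge-suc {x} refl refl = dec-true (x <? suc x) ℕ.≤-refl

    grid : Tiling n
    grid = Vec.tabulate λ i → Vec.tabulate λ j → tileAt (toℕ i) (toℕ j)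

    grid-at : ∀ i j → grid at (i , j) ≡ tileAt (toℕ i) (toℕ j)
    grid-at i j = trans (cong (λ v → lookup v j) (Vec.lookup∘tabulate _ i)) (Vec.lookup∘tabulate _ j)

    outside-col : ∀ a → a ≤ n → r a n ≡ a
    outside-col a p = trans (outside a n (inj₂ ℕ.≤-refl)) (ℕ.m≤n⇒m⊓n≡m p)
    outside-row : ∀ b → b ≤ n → r n b ≡ b
    outside-row b p = trans (outside n b (inj₁ ℕ.≤-refl)) (ℕ.m≥n⇒m⊓n≡n p)

  -- Neighbouring tiles match because both read their common edge off the same two vertices. On the
  -- right and bottom boundaries `outside` makes the height the row or column number, so it rises at
  -- each edge.
  fromHeight : BPD n
  fromHeight = record
    { tiling = grid
    ; match-horizontal = λ i {j} {j′} eq → trans (trans (cong right (grid-at i j)) (right≡ _ (toℕ j)))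
        (sym (trans (cong left (grid-at i j′)) (trans (left≡ _ (toℕ j′)) (cong (l (toℕ i)) eq))))
    ; match-vertical = λ {i} {i′} j eq → trans (trans (cong bottom (grid-at i j)) (bottom≡ (toℕ i) _))
        (sym (trans (cong top (grid-at i′ j)) (trans (top≡ (toℕ i′) _) (cong (λ i → t i (toℕ j)) eq))))
    ; left-boundary = λ i j eq → trans (cong left (grid-at i j)) (trans (left≡ (toℕ i) (toℕ j))
        (edge-≡ (trans (cong (r (toℕ i)) eq)
          (trans (trans (left-0 _) (sym (left-0 _))) (cong (r (suc (toℕ i))) (sym eq))))))
    ; top-boundary = λ i j eq → trans (cong top (grid-at i j)) (trans (top≡ (toℕ i) (toℕ j))
        (edge-≡ (trans (cong (flip r (toℕ j)) eq)
          (trans (trans (top-0 _) (sym (top-0 _))) (cong (flip r (suc (toℕ j))) (sym eq))))))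
    ; right-boundary = λ i j eq → trans (cong right (grid-at i j)) (trans (right≡ (toℕ i) (toℕ j))
        (edge-suc (trans (cong (r (toℕ i)) eq) (outside-col _ (ℕ.<⇒≤ (Fin.toℕ<n i))))
                  (trans (cong (r (suc (toℕ i))) eq) (outside-col _ (Fin.toℕ<n i)))))
    ; bottom-boundary = λ i j eq → trans (cong bottom (grid-at i j)) (trans (bottom≡ (toℕ i) (toℕ j))
        (edge-suc (trans (cong (flip r (toℕ j)) eq) (outside-row _ (ℕ.<⇒≤ (Fin.toℕ<n j))))
                  (trans (cong (flip r (suc (toℕ j))) eq) (outside-row _ (Fin.toℕ<n j)))))
    }

  height-fromHeight : ∀ a c → height fromHeight a c ≡ r a c
  height-fromHeight zero    c = sym (top-0 c)
  height-fromHeight (suc a) c = trans (cong (_+ β (left (extend grid a c))) (height-fromHeight a c))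
    (go (a <? n) (c <? n))
    where
    out : n ≤ a ⊎ n ≤ c → r a c + β (left (extend grid a c)) ≡ r (suc a) c
    out p = trans (cong₂ (λ x y → x + β (left y)) (outside a c p) (extend-outer grid a c p))
      (trans (sym (⊓-outer-left a c)) (sym (outside (suc a) c (map₁ ℕ.m≤n⇒m≤1+n p))))
    go : Dec (a < n) → Dec (c < n) → r a c + β (left (extend grid a c)) ≡ r (suc a) c
    go (no p)  _       = out (inj₁ (ℕ.≮⇒≥ p))
    go (yes _) (no q)  = out (inj₂ (ℕ.≮⇒≥ q))
    go (yes p) (yes q) = trans (cong (λ x → r a c + β x) (trans (cong left (trans (extend-< grid p q)
      (trans (grid-at _ _) (cong₂ tileAt (Fin.toℕ-fromℕ< p) (Fin.toℕ-fromℕ< q))))) (left≡ a c))) (sym (l-β a c))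

  fromHeight-hecke : HBPD n
  fromHeight-hecke = record { bpd = fromHeight ; shape = ƛ ; D≐shape = D⊆ , ⊆D }
    where
    module Ct = Counts (height-counts fromHeight)
    D⊆ : ∀ {c} → c ∈ D fromHeight → c ∈ 𝕐 ƛ
    D⊆ {a , c} d = from (shape⇔ a c) (hecke a c (trans (sym (height-fromHeight _ _))
      (trans (Ct.diagonal-edges a c) (trans (cong (λ x → height fromHeight a c + (β (left x) + β (bottom x)))
        (D⇒blank fromHeight d)) (trans (ℕ.+-identityʳ _) (height-fromHeight a c))))))
    ⊆D : ∀ {c} → c ∈ 𝕐 ƛ → c ∈ D fromHeight
    ⊆D {a , c} p = blank⇒D fromHeight (no-pipe⇒blank _ (ℕ.m+n≡0⇒n≡0 (height fromHeight a c)
      (trans (sym (Ct.diagonal-edges a c)) (trans (height-fromHeight _ _) (to (shape⇔ a c) p)))))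

-- The bijection

∈𝕐? : ∀ ƛ i j → Dec ((i , j) ∈ 𝕐 ƛ)
∈𝕐? ƛ i j = j <? ƛ ! i

module _ {m : ℕ} (S : DT m) where

  private ƛ = DT.shape S

  value : ℕ → ℕ → ℕ
  value i j with ∈𝕐? ƛ i j
  ... | yes p = entry S i j p
  ... | no  _ = 0

  value-∈ : ∀ {i j} .(p : (i , j) ∈ 𝕐 ƛ) → value i j ≡ entry S i j p
  value-∈ {i} {j} p with ∈𝕐? ƛ i j
  ... | yes _ = refl
  ... | no ¬p = ⊥-elim (¬p (recompute (∈𝕐? ƛ i j) p))

  value-∉ : ∀ {i j} → ¬ (i , j) ∈ 𝕐 ƛ → value i j ≡ 0
  value-∉ {i} {j} ¬p with ∈𝕐? ƛ i j
  ... | yes p = ⊥-elim (¬p p)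
  ... | no _  = refl

  shape⇔value : ∀ i j → (i , j) ∈ 𝕐 ƛ ⇔ 0 < value i j
  shape⇔value i j = mk⇔ (λ p → subst (0 <_) (sym (value-∈ p)) (DT.entry-pos S p)) pos⇒
    where
    pos⇒ : 0 < value i j → (i , j) ∈ 𝕐 ƛ
    pos⇒ pos with ∈𝕐? ƛ i j
    ... | yes p = p

  value-tableau : IsTableau m value
  value-tableau = record { row = row ; col = col ; bound = bound }
    where
    row : ∀ i j → 0 < value i (suc j) → value i (suc j) < value i j
    row i j pos = subst₂ _<_ (sym (value-∈ p′)) (sym (value-∈ p)) (DT.row-dec S p p′ ℕ.≤-refl)
      where
      p′ = from (shape⇔value i (suc j)) pos
      p  = 𝕐-lower ƛ (ℕ.≤-refl {i}) (ℕ.n≤1+n j) p′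
    col : ∀ i j → 0 < value (suc i) j → value (suc i) j < value i j
    col i j pos = subst₂ _<_ (sym (value-∈ p′)) (sym (value-∈ p)) (DT.col-dec S p p′ ℕ.≤-refl)
      where
      p′ = from (shape⇔value (suc i) j) pos
      p  = 𝕐-lower ƛ (ℕ.n≤1+n i) (ℕ.≤-refl {j}) p′
    bound : ∀ i j → value i j ≤ m
    bound i j with ∈𝕐? ƛ i j
    ... | yes p = DT.entry-≤ S p
    ... | no _  = z≤n

value-cong : ∀ {m} {S T : DT m} → S ≈ᵗ T → ∀ i j → value S i j ≡ value T i j
value-cong {S = S} {T} (shape≡ , entry≡) i j with ∈𝕐? (DT.shape S) i j
... | yes p = trans (entry≡ i j p q) (sym (value-∈ T q))
  where q = subst (λ xs → j < nth xs i) shape≡ p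
... | no ¬p = sym (value-∉ T (¬p ∘ subst (λ xs → j < nth xs i) (sym shape≡)))

module _ {m : ℕ} (P : HBPD (suc m)) where

  ΩEntry : ℕ → ℕ → ℕ
  ΩEntry = entryOf (height-isHeight P)

  ΩEntry-dual : Dual (height (bpd P)) ΩEntry
  ΩEntry-dual = entryOf-dual (height-isHeight P)

  ΩEntry-tableau : IsTableau m ΩEntry
  ΩEntry-tableau = dual-tableau (height-isHeight P) ΩEntry-dual

  shape⇔ΩEntry : ∀ {i j} → (i , j) ∈ 𝕐 (HBPD.shape P) ⇔ 0 < ΩEntry i j
  shape⇔ΩEntry {i} {j} = mk⇔
    (λ p → from (ΩEntry-dual 0 i j) (ℕ.≤-reflexive (shape⇒height-0 P p)))
    (λ pos → height-0⇒shape P (ℕ.n≤0⇒n≡0 (to (ΩEntry-dual 0 i j) pos)))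

  Ω : DT m
  Ω = record
    { shape     = ƛ
    ; entry     = λ i j _ → ΩEntry i j
    -- The sum of entry, row and column weakly decreases, so a larger column index forces a smaller
    -- entry; likewise for rows below.
    ; row-dec   = λ {i} {j} {j′} _ p′ j< → ℕ.+-cancelʳ-< (i + j) _ _ (ℕ.<-≤-trans
        (ℕ.+-monoʳ-< (ΩEntry i j′) (ℕ.+-monoʳ-< i j<))
        (descent ℕ.≤-refl (ℕ.<⇒≤ j<) (pos p′)))
    ; col-dec   = λ {i} {i′} {j} _ p′ i< → ℕ.+-cancelʳ-< (i + j) _ _ (ℕ.<-≤-trans
        (ℕ.+-monoʳ-< (ΩEntry i′ j) (ℕ.+-monoˡ-< j i<))
        (descent (ℕ.<⇒≤ i<) ℕ.≤-refl (pos p′)))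
    ; entry-pos = λ p → pos p
    ; entry-≤   = λ _ → IsTableau.bound ΩEntry-tableau _ _
    }
    where
    open Tableau ΩEntry-tableau
    ƛ = HBPD.shape P
    pos : ∀ {i j} → .((i , j) ∈ 𝕐 ƛ) → 0 < ΩEntry i j
    pos {i} {j} p = to shape⇔ΩEntry (recompute (∈𝕐? ƛ i j) p)

  value-Ω : ∀ i j → value Ω i j ≡ ΩEntry i j
  value-Ω i j with ∈𝕐? (HBPD.shape P) i j
  ... | yes _ = refl
  ... | no ¬p = sym (ℕ.n≤0⇒n≡0 (ℕ.≮⇒≥ (¬p ∘ from shape⇔ΩEntry)))

height-cong : ∀ {n} (P Q : BPD n) → tiling P ≡ tiling Q → ∀ a b → height P a b ≡ height Q a b
height-cong P Q eq zero    b = refl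
height-cong P Q eq (suc a) b =
  cong₂ _+_ (height-cong P Q eq a b) (cong (λ t → β (left (extend t a b))) eq)

Ω-cong : ∀ {m} {P Q : HBPD (suc m)} → P ≈ʰ Q → Ω P ≈ᵗ Ω Q
Ω-cong {P = P} {Q} eq =
  𝕐-injective {HBPD.shape P} {HBPD.shape Q} (incl P Q eq , incl Q P (sym eq)) ,
  λ i j _ _ → dual-functional (ΩEntry-dual P) (ΩEntry-dual Q) (height-cong (bpd P) (bpd Q) eq) i j
  where
  incl : ∀ (P Q : HBPD _) → P ≈ʰ Q → ∀ {c} → c ∈ 𝕐 (HBPD.shape P) → c ∈ 𝕐 (HBPD.shape Q)
  incl P Q eq {a , b} p = blank⇒shape Q
    (trans (cong (λ t → extend t a b) (sym eq)) (shape⇒blank P p))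

tiling-ext : ∀ {n} (s t : Tiling n) → (∀ c → s at c ≡ t at c) → s ≡ t
tiling-ext s t eq = begin
  s                                           ≡⟨ eta s ⟨
  Vec.tabulate (λ i → Vec.tabulate λ j → s at (i , j))
    ≡⟨ Vec.tabulate-cong (λ i → Vec.tabulate-cong λ j → eq (i , j)) ⟩
  Vec.tabulate (λ i → Vec.tabulate λ j → t at (i , j)) ≡⟨ eta t ⟩
  t                                           ∎
  where
  open ≡-Reasoning
  eta : ∀ {n} (t : Tiling n) → Vec.tabulate (λ i → Vec.tabulate λ j → t at (i , j)) ≡ t
  eta t = trans (Vec.tabulate-cong λ i → Vec.tabulate∘lookup (lookup t i)) (Vec.tabulate∘lookup t)

-- Duality recovers the heights from the tableau, and the heights recover the tiles.
Ω-injective : ∀ {m} {P Q : HBPD (suc m)} → Ω P ≈ᵗ Ω Q → P ≈ʰ Q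
Ω-injective {P = P} {Q} eq = tiling-ext (tiling (bpd P)) (tiling (bpd Q)) λ (i , j) → begin
  tiling (bpd P) at (i , j)       ≡⟨ extend-inner (tiling (bpd P)) i j ⟨
  tiles (bpd P) (toℕ i) (toℕ j)
    ≡⟨ Counts-unique (height-counts (bpd P)) (height-counts (bpd Q)) heights≡ (toℕ i) (toℕ j) ⟩
  tiles (bpd Q) (toℕ i) (toℕ j)   ≡⟨ extend-inner (tiling (bpd Q)) i j ⟩
  tiling (bpd Q) at (i , j)       ∎
  where
  open ≡-Reasoning
  heights≡ : ∀ a b → height (bpd P) a b ≡ height (bpd Q) a b
  heights≡ = dual-injective (height-isHeight P) (height-isHeight Q) (ΩEntry-dual P) (ΩEntry-dual Q)
    (λ i j → trans (sym (value-Ω P i j)) (trans (value-cong {S = Ω P} {Ω Q} eq i j) (value-Ω Q i j)))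

module _ {m : ℕ} (S : DT m) where

  private
    S-tableau = value-tableau S
    S-dual = heightOf-dual S-tableau
    module S = FromHeight (heightOf-isHeight S-tableau) (DT.shape S)
      -- The case k = 0 of duality: positive entries are the cells whose southeast height vanishes.
      (λ i j → mk⇔ (λ p → ℕ.n≤0⇒n≡0 (to (S-dual 0 i j) (to (shape⇔value S i j) p)))
                   (λ eq → from (shape⇔value S i j) (from (S-dual 0 i j) (ℕ.≤-reflexive eq))))

  Ω⁻¹ : HBPD (suc m)
  Ω⁻¹ = S.fromHeight-hecke

  Ω-Ω⁻¹ : Ω Ω⁻¹ ≈ᵗ S
  Ω-Ω⁻¹ = refl , λ i j p q → trans
    (dual-functional (ΩEntry-dual Ω⁻¹) S-dual S.height-fromHeight i j) (value-∈ S q)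

≈ᵗ-isEquivalence : ∀ {m} → IsEquivalence (_≈ᵗ_ {m})
≈ᵗ-isEquivalence = record
  { refl  = refl , λ i j _ _ → refl
  ; sym   = λ (p , q) → sym p , λ i j x y → sym (q i j y x)
  ; trans = λ {S} {T} (p , q) (p′ , q′) → trans p p′ , λ i j x y →
      trans (q i j x (subst (λ xs → j < nth xs i) p x)) (q′ i j (subst (λ xs → j < nth xs i) p x) y)
  }

Ω-bijection : ∀ {m} → IsBijection _≈ʰ_ _≈ᵗ_ (Ω {m})
Ω-bijection = record
  { isInjection = record
    { isCongruent = record
      { cong           = λ {P} {Q} → Ω-cong {P = P} {Q}
      ; isEquivalence₁ = record { refl = refl ; sym = sym ; trans = trans }
      ; isEquivalence₂ = ≈ᵗ-isEquivalence
      }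
    ; injective = λ {P} {Q} → Ω-injective {P = P} {Q}
    }
  ; surjective = λ S → Ω⁻¹ S , λ {P} eq → IsEquivalence.trans ≈ᵗ-isEquivalence
      {Ω P} {Ω (Ω⁻¹ S)} {S} (Ω-cong {P = P} {Ω⁻¹ S} eq) (Ω-Ω⁻¹ S)
  }

-- Paired blanks and crossings

module _ {m : ℕ} (P : HBPD (suc m)) where

  private
    r = height (bpd P)
    τ = tiles (bpd P)
    T = ΩEntry P
    dual = ΩEntry-dual P
    module Ct = Counts (height-counts (bpd P))

  crossing⇒height : ∀ {a b} → τ a b ≡ crossing → r (suc a) (suc b) ≡ 2 + r a b
  crossing⇒height {a} {b} eq = trans (Ct.diagonal-edges a b)
    (trans (cong (λ t → r a b + (β (left t) + β (bottom t))) eq) (ℕ.+-comm _ 2))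

  -- The height jumps from k to k + 2 at the crossing, so the inequality of duality holds for k and
  -- fails for k + 1.
  crossing⇒entry : ∀ {k i j} → τ (suc (k + i)) (suc (k + j)) ≡ crossing →
                   r (suc (k + i)) (suc (k + j)) ≡ k → T i j ≡ suc k
  crossing⇒entry {k} {i} {j} eq r≡k = ℕ.≤-antisym
    (ℕ.≮⇒≥ λ q → ℕ.n≮n (suc k)
      (subst (_≤ suc k) (trans (crossing⇒height eq) (cong (2 +_) r≡k)) (to (dual (suc k) i j) q)))
    (from (dual k i j) (ℕ.≤-reflexive r≡k))

  -- Duality for k and k + 1 puts the height at most k before the cell and at least k + 2 after it.
  -- A diagonal step rises by at most 2, so both bounds are attained.
  entry⇒crossing : ∀ {k i j} → T i j ≡ suc k →
                   τ (suc (k + i)) (suc (k + j)) ≡ crossing × r (suc (k + i)) (suc (k + j)) ≡ k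
  entry⇒crossing {k} {i} {j} eq = two-pipes⇒crossing t (ℕ.+-cancelˡ-≤ k _ _ (begin
      k + 2                                   ≡⟨ ℕ.+-comm k 2 ⟩
      2 + k                                   ≤⟨ above ⟩
      r (suc a) (suc b)                       ≡⟨ Ct.diagonal-edges a b ⟩
      r a b + (β (left t) + β (bottom t))     ≤⟨ ℕ.+-monoˡ-≤ _ below ⟩
      k + (β (left t) + β (bottom t))         ∎))
    , ℕ.≤-antisym below (ℕ.+-cancelˡ-≤ 2 _ _ (begin
      2 + k                                   ≤⟨ above ⟩
      r (suc a) (suc b)                       ≡⟨ Ct.diagonal-edges a b ⟩
      r a b + (β (left t) + β (bottom t))     ≤⟨ ℕ.+-monoʳ-≤ (r a b)
                                                 (ℕ.+-mono-≤ (β-≤1 (left t)) (β-≤1 (bottom t))) ⟩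
      r a b + 2                               ≡⟨ ℕ.+-comm (r a b) 2 ⟩
      2 + r a b                               ∎))
    where
    open ℕ.≤-Reasoning
    a = suc (k + i)
    b = suc (k + j)
    t = τ a b
    below : r a b ≤ k
    below = to (dual k i j) (ℕ.≤-reflexive (sym eq))
    above : 2 + k ≤ r (suc a) (suc b)
    above = ℕ.≰⇒> λ q → ℕ.n≮n (suc k) (subst (suc k <_) eq (from (dual (suc k) i j) q))

  -- The blank is found `r a b` + 1 steps northwest. There is room for these steps, since otherwise
  -- the jump by 2 would exceed the coordinate bound at the southeast vertex.
  crossing-blank : ∀ {a b} → τ a b ≡ crossing →
                   ∃₂ λ i j → a ≡ suc (r a b + i) × b ≡ suc (r a b + j) × T i j ≡ suc (r a b)
  crossing-blank {a} {b} eq with ≤⊎> (r a b) a | ≤⊎> (r a b) b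
  ... | inj₁ p | _ = ⊥-elim (ℕ.n≮n (suc (r a b))
                       (ℕ.≤-trans (subst (_≤ suc a) (crossing⇒height {a} {b} eq)
                       (IsHeight.≤-row (height-isHeight P) (suc a) (suc b))) (s≤s p)))
  ... | _ | inj₁ p = ⊥-elim (ℕ.n≮n (suc (r a b))
                       (ℕ.≤-trans (subst (_≤ suc b) (crossing⇒height {a} {b} eq)
                       (IsHeight.≤-col (height-isHeight P) (suc a) (suc b))) (s≤s p)))
  ... | inj₂ (i , p) | inj₂ (j , q) = i , j , p , q ,
    crossing⇒entry (trans (sym (cong₂ τ p q)) eq) (sym (cong₂ r p q))

  entry-within : ∀ {i j} → 0 < T i j → T i j + i ≤ m × T i j + j ≤ m
  entry-within {i} {j} pos = Tableau.row-bound (ΩEntry-tableau P) i j pos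
                           , Tableau.row-bound (transposed (ΩEntry-tableau P)) j i pos

  blank⇔entry : ∀ {i j} → τ i j ≡ blank ⇔ 0 < T i j
  blank⇔entry = mk⇔ (to (shape⇔ΩEntry P) ∘ blank⇒shape P) (shape⇒blank P ∘ from (shape⇔ΩEntry P))

⊖-cong : ∀ {a b c d} → a + d ≡ c + b → a ⊖ b ≡ c ⊖ d
⊖-cong {a} {b} {c} {d} eq = begin
  a ⊖ b             ≡⟨ ℤ.+-cancelˡ-⊖ d a b ⟨
  (d + a) ⊖ (d + b) ≡⟨ cong₂ _⊖_ (trans (ℕ.+-comm d a) (trans eq (ℕ.+-comm c b))) (ℕ.+-comm d b) ⟩
  (b + c) ⊖ (b + d) ≡⟨ ℤ.+-cancelˡ-⊖ b c d ⟩
  c ⊖ d             ∎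
  where open ≡-Reasoning

⊖-injective : ∀ {a b c d} → a ⊖ b ≡ c ⊖ d → a + d ≡ c + b
⊖-injective {a} {b} {c} {d} eq = trans (ℕ.+-comm a d) (trans (ℤ.+-injective
  (∙-cancelʳ ℤ.+-0-abelianGroup (ℤ.- ℤ.+ (d + b)) _ _ (begin
  ℤ.+ (d + a) ℤ.+ (ℤ.- ℤ.+ (d + b)) ≡⟨ ℤ.m-n≡m⊖n (d + a) (d + b) ⟩
  (d + a) ⊖ (d + b)           ≡⟨ ℤ.+-cancelˡ-⊖ d a b ⟩
  a ⊖ b                       ≡⟨ eq ⟩
  c ⊖ d                       ≡⟨ ℤ.+-cancelˡ-⊖ b c d ⟨
  (b + c) ⊖ (b + d)           ≡⟨ cong ((b + c) ⊖_) (ℕ.+-comm b d) ⟩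
  (b + c) ⊖ (d + b)           ≡⟨ ℤ.m-n≡m⊖n (b + c) (d + b) ⟨
  ℤ.+ (b + c) ℤ.+ (ℤ.- ℤ.+ (d + b)) ∎))) (ℕ.+-comm b c))
  where open ≡-Reasoning

module _ {A : Set} where

  AllPairs-reverse : ∀ {R : A → A → Set} {xs} → AllPairs R xs → AllPairs (flip R) (reverse xs)
  AllPairs-reverse [] = []
  AllPairs-reverse {R} {x ∷ xs} (p ∷ ps) rewrite List.unfold-reverse x xs =
    AllPairs.++⁺ (AllPairs-reverse ps) ([] ∷ [])
      (All.tabulate λ y∈ → All.lookup p (Any.reverse⁻ y∈) ∷ [])

  AllPairs-map-∈ : ∀ {R S : A → A → Set} {xs} → (∀ {x y} → x ∈ˡ xs → y ∈ˡ xs → R x y → S x y) →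
                   AllPairs R xs → AllPairs S xs
  AllPairs-map-∈ f []       = []
  AllPairs-map-∈ f (p ∷ ps) = All.tabulate (λ y∈ → f (here refl) (there y∈) (All.lookup p y∈))
    ∷ AllPairs-map-∈ (λ x∈ y∈ → f (there x∈) (there y∈)) ps

  ∈-zip-map : ∀ {B : Set} (f : A → B) {x xs} → x ∈ˡ xs → (x , f x) ∈ˡ zip xs (map f xs)
  ∈-zip-map f (here refl) = here refl
  ∈-zip-map f (there x∈)  = there (∈-zip-map f x∈)

Lexicographic : ∀ {A B : Set} → (A → A → Set) → (B → B → Set) → A × B → A × B → Set
Lexicographic R S (a , b) (a′ , b′) = R a a′ ⊎ a ≡ a′ × S b b′

cartesianProduct-sorted : ∀ {A B : Set} {R : A → A → Set} {S : B → B → Set} {xs ys} →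
                          AllPairs R xs → AllPairs S ys →
                          AllPairs (Lexicographic R S) (cartesianProduct xs ys)
cartesianProduct-sorted [] sorted = []
cartesianProduct-sorted {R = R} {S} {x ∷ xs} {ys} (p ∷ ps) sorted = AllPairs.++⁺
  (AllPairs.map⁺ (AllPairs.map (λ q → inj₂ (refl , q)) sorted)) (cartesianProduct-sorted ps sorted)
  (All.tabulate λ y∈ → All.tabulate λ z∈ → below (∈-map⁻ (x ,_) y∈) (∈-cartesianProduct⁻ xs ys z∈))
  where
  below : ∀ {y z} → ∃ (λ b → b ∈ˡ ys × y ≡ (x , b)) →
          proj₁ z ∈ˡ xs × proj₂ z ∈ˡ ys → Lexicographic R S y z
  below (_ , _ , refl) (a∈ , _) = inj₁ (All.lookup p a∈)

Lex : ∀ {n} → Cell n → Cell n → Set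
Lex = Lexicographic Fin._<_ Fin._<_

Lex-asym : ∀ {n} {x y : Cell n} → Lex x y → ¬ Lex y x
Lex-asym (inj₁ p)          (inj₁ q)          = ℕ.<-asym p q
Lex-asym (inj₁ p)          (inj₂ (refl , _)) = ℕ.n≮n _ p
Lex-asym (inj₂ (refl , _)) (inj₁ q)          = ℕ.n≮n _ q
Lex-asym (inj₂ (_ , p))    (inj₂ (_ , q))    = ℕ.<-asym p q

cells-sorted : ∀ n → AllPairs Lex (cells n)
cells-sorted n = cartesianProduct-sorted
  (AllPairs.tabulate⁺-< {R = Fin._<_} (λ p → p)) (AllPairs.tabulate⁺-< {R = Fin._<_} (λ p → p))

module _ {m : ℕ} (P : HBPD (suc m)) (c : ℤ) where

  private
    B = bpd P
    n = suc m
    r = height B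
    T = ΩEntry P

    onDiagonal? : (x : Cell n) → Dec (toℕ (proj₂ x) ⊖ toℕ (proj₁ x) ≡ c)
    onDiagonal? x = (toℕ (proj₂ x) ⊖ toℕ (proj₁ x)) ℤ.≟ c

  ∈-tilesOn : ∀ {t} {x : Cell n} →
              x ∈ˡ tilesOn B t c ⇔ (tiling B at x ≡ t × toℕ (proj₂ x) ⊖ toℕ (proj₁ x) ≡ c)
  ∈-tilesOn {t} {x} = mk⇔
    (λ x∈ → let x∈′ , at-x = ∈-filter⁻ (λ x → (tiling B at x) ≟ᵗ t) {xs = diagonal n c} x∈
            in  at-x , proj₂ (∈-filter⁻ onDiagonal? {xs = cells n} x∈′))
    (λ (at-x , on) → ∈-filter⁺ (λ x → (tiling B at x) ≟ᵗ t)
      (∈-filter⁺ onDiagonal? (∈-cartesianProduct⁺ (∈-allFin _) (∈-allFin _)) on) at-x)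

  tilesOn-sorted : ∀ t → AllPairs Lex (tilesOn B t c)
  tilesOn-sorted t = AllPairs.filter⁺ (λ x → (tiling B at x) ≟ᵗ t) {xs = diagonal n c}
    (AllPairs.filter⁺ onDiagonal? {xs = cells n} (cells-sorted n))

  private
    -- Clamping makes `partner` total; on blanks it changes nothing, by `entry-within`.
    cap : ℕ → Fin n
    cap k = fromℕ< (s≤s (ℕ.m⊓n≤m m k))

    toℕ-cap : ∀ {k} → k ≤ m → toℕ (cap k) ≡ k
    toℕ-cap {k} p = trans (Fin.toℕ-fromℕ< (s≤s (ℕ.m⊓n≤m m k))) (ℕ.m≥n⇒m⊓n≡n p)

  partner : Cell n → Cell n
  partner (i , j) = cap (T (toℕ i) (toℕ j) + toℕ i) , cap (T (toℕ i) (toℕ j) + toℕ j)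

  partner-row : ∀ i j → 0 < T (toℕ i) (toℕ j) → toℕ (proj₁ (partner (i , j))) ≡ T (toℕ i) (toℕ j) + toℕ i
  partner-row i j pos = toℕ-cap (proj₁ (entry-within P pos))

  partner-col : ∀ i j → 0 < T (toℕ i) (toℕ j) → toℕ (proj₂ (partner (i , j))) ≡ T (toℕ i) (toℕ j) + toℕ j
  partner-col i j pos = toℕ-cap (proj₂ (entry-within P pos))

  private
    blanks    = tilesOn B blank c
    crossings = tilesOn B crossing c

    blank-pos : ∀ {i j} → tiling B at (i , j) ≡ blank → 0 < T (toℕ i) (toℕ j)
    blank-pos {i} {j} eq = to (blank⇔entry P) (trans (extend-inner (tiling B) i j) eq)

    -- On a fixed diagonal a later blank is strictly southeast, and `descent` puts its crossing
    -- strictly further up.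
    partner-decreasing : ∀ {x y} → x ∈ˡ blanks → y ∈ˡ blanks → Lex x y → Lex (partner y) (partner x)
    partner-decreasing {i , j} {i′ , j′} x∈ y∈ lex = inj₁ (subst₂ _<_
        (sym (partner-row i′ j′ pos′)) (sym (partner-row i j (blank-pos (proj₁ x-on))))
        (ℕ.+-cancelʳ-< (toℕ j) _ _ (begin-strict
          T (toℕ i′) (toℕ j′) + toℕ i′ + toℕ j    <⟨ ℕ.+-monoʳ-< _ (proj₂ (southeast lex)) ⟩
          T (toℕ i′) (toℕ j′) + toℕ i′ + toℕ j′   ≡⟨ ℕ.+-assoc (T (toℕ i′) (toℕ j′)) _ _ ⟩
          T (toℕ i′) (toℕ j′) + (toℕ i′ + toℕ j′) ≤⟨ Tableau.descent (ΩEntry-tableau P)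
                                                      (ℕ.<⇒≤ (proj₁ (southeast lex))) (ℕ.<⇒≤ (proj₂ (southeast lex))) pos′ ⟩
          T (toℕ i) (toℕ j) + (toℕ i + toℕ j)     ≡⟨ ℕ.+-assoc (T (toℕ i) (toℕ j)) _ _ ⟨
          T (toℕ i) (toℕ j) + toℕ i + toℕ j       ∎)))
      where
      open ℕ.≤-Reasoning
      x-on = to ∈-tilesOn x∈
      y-on = to ∈-tilesOn y∈
      pos′ = blank-pos {i′} {j′} (proj₁ y-on)
      same : toℕ j + toℕ i′ ≡ toℕ j′ + toℕ i
      same = ⊖-injective {toℕ j} {toℕ i} {toℕ j′} {toℕ i′} (trans (proj₂ x-on) (sym (proj₂ y-on)))
      southeast : Lex (i , j) (i′ , j′) → toℕ i < toℕ i′ × toℕ j < toℕ j′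
      southeast (inj₁ i<) = i< , ℕ.+-cancelʳ-< (toℕ i) _ _
        (subst (toℕ j + toℕ i <_) same (ℕ.+-monoʳ-< (toℕ j) i<))
      southeast (inj₂ (refl , j<)) = ⊥-elim (ℕ.<⇒≢ j< (ℕ.+-cancelʳ-≡ (toℕ i) _ _ same))

    crossing⇒partner : ∀ {y} → y ∈ˡ crossings → y ∈ˡ map partner blanks
    crossing⇒partner {a , b} y∈ with to ∈-tilesOn y∈
    ... | at-y , on-y with crossing-blank P (trans (extend-inner (tiling B) a b) at-y)
    ... | i , j , a≡ , b≡ , T≡ = subst (_∈ˡ map partner blanks) partner≡ (∈-map⁺ partner (from ∈-tilesOn
        ( trans (sym (extend-inner (tiling B) i′ j′)) (from (blank⇔entry P) pos)
        , trans (⊖-cong {toℕ j′} {toℕ i′} {toℕ b} {toℕ a} (diag (toℕ a) (toℕ b) i≡ j≡)) on-y)))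
      where
      k = r (toℕ a) (toℕ b)
      i<n : i < n
      i<n = ℕ.≤-<-trans (ℕ.≤-trans (ℕ.m≤n+m i (suc k)) (ℕ.≤-reflexive (sym a≡))) (Fin.toℕ<n a)
      j<n : j < n
      j<n = ℕ.≤-<-trans (ℕ.≤-trans (ℕ.m≤n+m j (suc k)) (ℕ.≤-reflexive (sym b≡))) (Fin.toℕ<n b)
      i′ = fromℕ< i<n
      j′ = fromℕ< j<n
      i≡ : toℕ a ≡ suc k + toℕ i′
      i≡ = trans a≡ (cong (suc k +_) (sym (Fin.toℕ-fromℕ< i<n)))
      j≡ : toℕ b ≡ suc k + toℕ j′
      j≡ = trans b≡ (cong (suc k +_) (sym (Fin.toℕ-fromℕ< j<n)))
      T≡′ : T (toℕ i′) (toℕ j′) ≡ suc k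
      T≡′ = trans (cong₂ T (Fin.toℕ-fromℕ< i<n) (Fin.toℕ-fromℕ< j<n)) T≡
      pos : 0 < T (toℕ i′) (toℕ j′)
      pos = subst (0 <_) (sym T≡′) (s≤s z≤n)
      diag : ∀ a b → a ≡ suc k + toℕ i′ → b ≡ suc k + toℕ j′ → toℕ j′ + a ≡ b + toℕ i′
      diag _ _ refl refl = swap (suc k) (toℕ i′) (toℕ j′)
        where
        swap : ∀ k i j → j + (k + i) ≡ k + j + i
        swap = solve-∀
      partner≡ : partner (i′ , j′) ≡ (a , b)
      partner≡ = cong₂ _,_
        (Fin.toℕ-injective (trans (partner-row i′ j′ pos) (trans (cong (_+ toℕ i′) T≡′) (sym i≡))))
        (Fin.toℕ-injective (trans (partner-col i′ j′ pos) (trans (cong (_+ toℕ j′) T≡′) (sym j≡))))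

    partner⇒crossing : ∀ {x} → x ∈ˡ blanks → partner x ∈ˡ crossings
    partner⇒crossing {i , j} x∈ = from ∈-tilesOn
      ( trans (sym (extend-inner (tiling B) _ _))
          (trans (cong₂ (tiles B) (partner-row i j pos) (partner-col i j pos)) cross)
      , trans (cong₂ _⊖_ (partner-col i j pos) (partner-row i j pos))
              (trans (ℤ.+-cancelˡ-⊖ (T (toℕ i) (toℕ j)) (toℕ j) (toℕ i)) (proj₂ (to ∈-tilesOn x∈))))
      where
      pos = blank-pos {i} {j} (proj₁ (to ∈-tilesOn x∈))
      cross : tiles B (T (toℕ i) (toℕ j) + toℕ i) (T (toℕ i) (toℕ j) + toℕ j) ≡ crossing
      cross with T (toℕ i) (toℕ j) in eq | pos
      ... | suc k | _ = proj₁ (entry⇒crossing P eq)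

  -- Both lists run strictly from southeast to northwest and have the same members. Zipping
  -- therefore pairs each blank with its partner.
  reverse-crossings : reverse crossings ≡ map partner blanks
  reverse-crossings = sorted-unique (λ {x} {y} → Lex-asym {x = y} {x})
    (AllPairs-reverse (tilesOn-sorted crossing))
    (AllPairs.map⁺ (AllPairs-map-∈ partner-decreasing (tilesOn-sorted blank)))
    (λ y → mk⇔ (crossing⇒partner ∘ Any.reverse⁻) (reversed ∘ ∈-map⁻ partner))
    where
    reversed : ∀ {y} → Σ[ x ∈ Cell n ] (x ∈ˡ blanks × y ≡ partner x) → y ∈ˡ reverse crossings
    reversed (_ , x∈ , refl) = Any.reverse⁺ (partner⇒crossing x∈)

Ω-isΩ : ∀ {m} (P : HBPD (suc m)) → IsΩ P (Ω P)
Ω-isΩ {m} P = record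
  { domain = HBPD.D≐shape P
  ; value  = λ i j p → value′ i j (recompute (∈𝕐? (HBPD.shape P) (toℕ i) (toℕ j)) p)
  }
  where
  T = ΩEntry P
  value′ : ∀ (i j : Fin (suc m)) → (toℕ i , toℕ j) ∈ 𝕐 (HBPD.shape P) →
           ∃₂ λ i′ j′ → Paired (bpd P) (i , j) (i′ , j′) × ℤ.+ T (toℕ i) (toℕ j) ≡ toℕ i′ ⊖ toℕ i
  value′ i j p = proj₁ y , proj₂ y , paired , value≡
    where
    c = toℕ j ⊖ toℕ i
    y = partner P c (i , j)
    pos = to (shape⇔ΩEntry P) p
    paired : Paired (bpd P) (i , j) y
    paired = subst (λ ys → ((i , j) , y) ∈ˡ zip (tilesOn (bpd P) blank c) ys) (sym (reverse-crossings P c))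
      (∈-zip-map (partner P c) (from (∈-tilesOn P c)
        (trans (sym (extend-inner (tiling (bpd P)) i j)) (shape⇒blank P p) , refl)))
    value≡ : ℤ.+ T (toℕ i) (toℕ j) ≡ toℕ (proj₁ y) ⊖ toℕ i
    value≡ = begin
      T (toℕ i) (toℕ j) ⊖ 0
        ≡⟨ ⊖-cong {T (toℕ i) (toℕ j)} {0} {T (toℕ i) (toℕ j) + toℕ i} {toℕ i} (sym (ℕ.+-identityʳ _)) ⟩
      (T (toℕ i) (toℕ j) + toℕ i) ⊖ toℕ i         ≡⟨ cong (_⊖ toℕ i) (partner-row P c i j pos) ⟨
      toℕ (proj₁ y) ⊖ toℕ i                       ∎
      where open ≡-Reasoning

-- Labels along a sweep

data Fits : Label → Bool → Set where
  present : ∀ {x} → Fits (just x) true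
  absent  : Fits nothing false

present-labels : ∀ {m} → Vec Label m → List ℕ
present-labels []       = []
present-labels (x ∷ xs) = fromMaybe x ++ present-labels xs

crossingLetter : Tile → ℕ → Maybe ℕ
crossingLetter crossing q = just q
crossingLetter _        q = nothing

-- The number of labels preceding the two labels of a crossing on the sweep path is the height at
-- its northwest vertex, so this height serves as the letter, numbered from 0.
rowWord : (ℕ → Tile) → (ℕ → ℕ) → ℕ → List ℕ
rowWord g f m = catMaybes (applyUpTo (λ b → crossingLetter (g b) (f b)) m)

propagate-fits : ∀ t {l b} → Fits l (left t) → Fits b (bottom t) →
                 Fits (proj₁ (propagate t l b)) (right t) × Fits (proj₂ (propagate t l b)) (top t)
propagate-fits downElbow  absent  present = present , absent
propagate-fits upElbow    present absent  = absent , present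
propagate-fits crossing   present present = present , present
propagate-fits blank      absent  absent  = absent , absent
propagate-fits horizontal present absent  = present , absent
propagate-fits vertical   absent  present = absent , present

-- Moving the path across a tile replaces the left and bottom labels by the top and right ones. Only
-- a crossing can change the list of labels present: the larger label leaves through the top and so
-- comes first.
propagate-sorts : ∀ t {l b} → Fits l (left t) → Fits b (bottom t) → ∀ pre rest →
  foldl sortAt (pre ++ fromMaybe l ++ fromMaybe b ++ rest) (fromMaybe (crossingLetter t (length pre)))
  ≡ pre ++ fromMaybe (proj₂ (propagate t l b)) ++ fromMaybe (proj₁ (propagate t l b)) ++ rest
propagate-sorts downElbow  absent  present pre rest = refl
propagate-sorts upElbow    present absent  pre rest = refl
propagate-sorts crossing (present {x}) (present {y}) pre rest =
  trans (cong (sortAt _) (sym (ℕ.+-identityʳ (length pre)))) (sortAt-++ pre (x ∷ y ∷ rest) 0)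
propagate-sorts blank      absent  absent  pre rest = refl
propagate-sorts horizontal present absent  pre rest = refl
propagate-sorts vertical   absent  present pre rest = refl

length-fits : ∀ {u x} → Fits u x → length (fromMaybe u) ≡ β x
length-fits present = refl
length-fits absent  = refl

catMaybes-∷ : ∀ {A : Set} (x : Maybe A) xs → catMaybes (x ∷ xs) ≡ fromMaybe x ++ catMaybes xs
catMaybes-∷ (just _) xs = refl
catMaybes-∷ nothing  xs = refl

-- The labels along the path that runs above the processed tiles of a row, down,
-- and then below the remaining ones, are sorted at each crossing.
propagateRow-sorts : ∀ {m} (ts : Vec Tile m) (g : ℕ → Tile) (f : ℕ → ℕ) →
  (∀ j → lookup ts j ≡ g (toℕ j)) → (∀ b → right (g b) ≡ left (g (suc b))) →
  (∀ b → f (suc b) ≡ f b + β (top (g b))) →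
  ∀ l bs → Fits l (left (g 0)) → (∀ j → Fits (lookup bs j) (bottom (g (toℕ j)))) →
  ∀ pre rest → length pre ≡ f 0 →
  foldl sortAt (pre ++ fromMaybe l ++ present-labels bs ++ rest) (rowWord g f m)
    ≡ pre ++ present-labels (proj₂ (propagateRow ts l bs)) ++ fromMaybe (proj₁ (propagateRow ts l bs)) ++ rest
  × (∀ j → Fits (lookup (proj₂ (propagateRow ts l bs)) j) (top (g (toℕ j))))
propagateRow-sorts [] g f _ _ _ l [] _ _ pre rest _ = refl , λ ()
propagateRow-sorts {suc m} (t ∷ ts) g f rep match edge l (b ∷ bs) fit-l fit-bs pre rest len =
  sorts , λ { zero → subst (Fits u) (cong top (rep zero)) fit-u ; (suc j) → proj₂ ih j }
  where
  r = proj₁ (propagate t l b)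
  u = proj₂ (propagate t l b)
  fit-l′ : Fits l (left t)
  fit-l′ = subst (Fits l) (cong left (sym (rep zero))) fit-l
  fit-b′ : Fits b (bottom t)
  fit-b′ = subst (Fits b) (cong bottom (sym (rep zero))) (fit-bs zero)
  fit-r = proj₁ (propagate-fits t fit-l′ fit-b′)
  fit-u = proj₂ (propagate-fits t fit-l′ fit-b′)
  -- The prefix grows by the label leaving through the top exactly as the height grows by the top
  -- edge, so the next letter is again a position.
  len′ : length (pre ++ fromMaybe u) ≡ f 1
  len′ = trans (List.length-++ pre) (trans (cong₂ _+_ len
    (trans (length-fits fit-u) (cong (β ∘ top) (rep zero)))) (sym (edge 0)))
  ih = propagateRow-sorts ts (g ∘ suc) (f ∘ suc) (rep ∘ suc) (match ∘ suc) (edge ∘ suc) r bs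
    (subst (Fits r) (trans (cong right (rep zero)) (match 0)) fit-r) (fit-bs ∘ suc)
    (pre ++ fromMaybe u) rest len′
  us = proj₂ (propagateRow ts r bs)
  r′ = proj₁ (propagateRow ts r bs)
  word = rowWord (g ∘ suc) (f ∘ suc) m
  open ≡-Reasoning
  sorts : foldl sortAt (pre ++ fromMaybe l ++ (fromMaybe b ++ present-labels bs) ++ rest) (rowWord g f (suc m))
          ≡ pre ++ (fromMaybe u ++ present-labels us) ++ fromMaybe r′ ++ rest
  sorts = begin
    foldl sortAt (pre ++ fromMaybe l ++ (fromMaybe b ++ present-labels bs) ++ rest) (rowWord g f (suc m))
      ≡⟨ cong₂ (foldl sortAt) (cong (λ xs → pre ++ fromMaybe l ++ xs) (List.++-assoc (fromMaybe b) _ _))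
           (trans (catMaybes-∷ (crossingLetter (g 0) (f 0))
               (applyUpTo (λ b → crossingLetter (g (suc b)) (f (suc b))) m))
             (cong₂ (λ t q → fromMaybe (crossingLetter t q) ++ word) (sym (rep zero)) (sym len))) ⟩
    foldl sortAt (pre ++ fromMaybe l ++ fromMaybe b ++ present-labels bs ++ rest)
      (fromMaybe (crossingLetter t (length pre)) ++ word)
      ≡⟨ List.foldl-++ sortAt _ (fromMaybe (crossingLetter t (length pre))) word ⟩
    foldl sortAt (foldl sortAt (pre ++ fromMaybe l ++ fromMaybe b ++ present-labels bs ++ rest)
      (fromMaybe (crossingLetter t (length pre)))) word
      ≡⟨ cong (λ s → foldl sortAt s word) (propagate-sorts t fit-l′ fit-b′ pre (present-labels bs ++ rest)) ⟩
    foldl sortAt (pre ++ fromMaybe u ++ fromMaybe r ++ present-labels bs ++ rest) word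
      ≡⟨ cong (λ s → foldl sortAt s word) (List.++-assoc pre (fromMaybe u) _) ⟨
    foldl sortAt ((pre ++ fromMaybe u) ++ fromMaybe r ++ present-labels bs ++ rest) word
      ≡⟨ proj₁ ih ⟩
    (pre ++ fromMaybe u) ++ present-labels us ++ fromMaybe r′ ++ rest
      ≡⟨ List.++-assoc pre (fromMaybe u) _ ⟩
    pre ++ fromMaybe u ++ present-labels us ++ fromMaybe r′ ++ rest
      ≡⟨ cong (pre ++_) (List.++-assoc (fromMaybe u) _ _) ⟨
    pre ++ (fromMaybe u ++ present-labels us) ++ fromMaybe r′ ++ rest ∎

concatMap-downFrom : ∀ {A : Set} (f : ℕ → List A) k →
                     concatMap f (downFrom (suc k)) ≡ concatMap (f ∘ suc) (downFrom k) ++ f 0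
concatMap-downFrom f zero    = List.++-identityʳ (f 0)
concatMap-downFrom f (suc k) = trans (cong (f (suc k) ++_) (concatMap-downFrom f k))
  (sym (List.++-assoc (f (suc k)) _ _))

-- The rows below are swept first. Labels that have left on the right form a suffix untouched by the
-- next row, whose own outgoing label is placed before it, so the right boundary is read from the
-- top.
propagateRows-sorts : ∀ {k m} (tss : Vec (Vec Tile m) k) (τ : ℕ → ℕ → Tile) (r : ℕ → ℕ → ℕ) →
  (∀ i j → lookup (lookup tss i) j ≡ τ (toℕ i) (toℕ j)) →
  (∀ a b → right (τ a b) ≡ left (τ a (suc b))) → (∀ a b → bottom (τ a b) ≡ top (τ (suc a) b)) →
  (∀ a → left (τ a 0) ≡ false) → (∀ a → r a 0 ≡ 0) →
  (∀ a b → r a (suc b) ≡ r a b + β (top (τ a b))) →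
  ∀ bs → (∀ j → Fits (lookup bs j) (top (τ k (toℕ j)))) →
  foldl sortAt (present-labels bs) (concatMap (λ a → rowWord (τ a) (r a) m) (downFrom k))
    ≡ present-labels (proj₂ (propagateRows tss bs)) ++ present-labels (proj₁ (propagateRows tss bs))
  × (∀ j → Fits (lookup (proj₂ (propagateRows tss bs)) j) (top (τ 0 (toℕ j))))
propagateRows-sorts [] τ r _ _ _ _ _ _ bs fit = sym (List.++-identityʳ _) , fit
propagateRows-sorts {suc k} {m} (ts ∷ tss) τ r rep matchʰ matchᵛ left-0 r-0 edge bs fit = sorts , proj₂ row
  where
  us = proj₂ (propagateRows tss bs)
  rs = proj₁ (propagateRows tss bs)
  ih = propagateRows-sorts tss (τ ∘ suc) (r ∘ suc) (rep ∘ suc) (matchʰ ∘ suc) (matchᵛ ∘ suc)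
    (left-0 ∘ suc) (r-0 ∘ suc) (edge ∘ suc) bs fit
  row = propagateRow-sorts ts (τ 0) (r 0) (rep zero) (matchʰ 0) (edge 0) nothing us
    (subst (Fits nothing) (sym (left-0 0)) absent)
    (λ j → subst (Fits (lookup us j)) (sym (matchᵛ 0 (toℕ j))) (proj₂ ih j))
    [] (present-labels rs) (sym (r-0 0))
  word : ℕ → List ℕ
  word a = rowWord (τ a) (r a) m
  open ≡-Reasoning
  sorts = begin
    foldl sortAt (present-labels bs) (concatMap word (downFrom (suc k)))
      ≡⟨ cong (foldl sortAt (present-labels bs)) (concatMap-downFrom word k) ⟩
    foldl sortAt (present-labels bs) (concatMap (word ∘ suc) (downFrom k) ++ word 0)
      ≡⟨ List.foldl-++ sortAt _ (concatMap (word ∘ suc) (downFrom k)) (word 0) ⟩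
    foldl sortAt (foldl sortAt (present-labels bs) (concatMap (word ∘ suc) (downFrom k))) (word 0)
      ≡⟨ cong (λ s → foldl sortAt s (word 0)) (proj₁ ih) ⟩
    foldl sortAt (present-labels us ++ present-labels rs) (word 0)
      ≡⟨ proj₁ row ⟩
    present-labels (proj₂ (propagateRow ts nothing us)) ++
      fromMaybe (proj₁ (propagateRow ts nothing us)) ++ present-labels rs ∎

present-labels-none : ∀ {m} (us : Vec Label m) → (∀ j → Fits (lookup us j) false) → present-labels us ≡ []
present-labels-none []       fit = refl
present-labels-none (u ∷ us) fit with u | fit zero
... | nothing | absent = present-labels-none us (fit ∘ suc)

present-labels-all : ∀ {m} (us : Vec Label m) (f : Fin m → ℕ) → (∀ j → lookup us j ≡ just (f j)) →
                     present-labels us ≡ List.tabulate f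
present-labels-all []       f eq = refl
present-labels-all (u ∷ us) f eq = cong₂ (λ v xs → fromMaybe v ++ xs) (eq zero)
  (present-labels-all us (f ∘ suc) (eq ∘ suc))

-- The path starts along the bottom boundary, where the labels form the identity. At the end no
-- label is on the top boundary, and those on the right boundary read w.
∂-sorts : ∀ {n} (P : BPD n) (w : Permutation′ n) → P ∈ Pipes w →
          foldl sortAt (List.tabulate {n = n} toℕ)
                (concatMap (λ a → rowWord (tiles P a) (height P a) n) (downFrom n)) ≡ oneLine w
∂-sorts {n} P w P∈ = begin
  foldl sortAt (List.tabulate {n = n} toℕ) word
    ≡⟨ cong (λ s → foldl sortAt s word) (present-labels-all bs toℕ (Vec.lookup∘tabulate _)) ⟨
  foldl sortAt (present-labels bs) word
    ≡⟨ proj₁ sorts ⟩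
  present-labels (proj₂ out) ++ present-labels (proj₁ out)
    ≡⟨ cong₂ _++_ (present-labels-none (proj₂ out) (λ j → subst (Fits _) (tiles-top P (toℕ j)) (proj₂ sorts j)))
                  (present-labels-all (proj₁ out) _ P∈) ⟩
  oneLine w ∎
  where
  open ≡-Reasoning
  word = concatMap (λ a → rowWord (tiles P a) (height P a) n) (downFrom n)
  bs : Vec Label n
  bs = Vec.tabulate (λ j → just (toℕ j))
  out = propagateRows (tiling P) bs
  sorts = propagateRows-sorts (tiling P) (tiles P) (height P) (λ i j → sym (extend-inner (tiling P) i j))
    (tiles-horizontal P) (tiles-vertical P) (tiles-left P) (height-col-0 P)
    (Counts.top-edge (height-counts P)) bs
    (λ j → subst₂ Fits (sym (Vec.lookup∘tabulate _ j))
      (sym (cong top (trans (extend-outer (tiling P) n (toℕ j) (inj₁ ℕ.≤-refl)) (outer-vertical (Fin.toℕ<n j)))))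
      present)

-- The column reading word

mapMaybe-filter : ∀ {A B : Set} {P : A → Set} (P? : ∀ x → Dec (P x)) (h : A → Maybe B) (k : A → B) →
                  (∀ x → P x → h x ≡ just (k x)) → (∀ x → ¬ P x → h x ≡ nothing) →
                  ∀ xs → mapMaybe h xs ≡ map k (filter P? xs)
mapMaybe-filter P? h k p q []       = refl
mapMaybe-filter P? h k p q (x ∷ xs) with P? x
... | yes Px rewrite p x Px  = cong (k x ∷_) (mapMaybe-filter P? h k p q xs)
... | no ¬Px rewrite q x ¬Px = mapMaybe-filter P? h k p q xs

concatMap-mapMaybe : ∀ {A B C : Set} (h : A × B → Maybe C) ys xs →
                     concatMap (λ x → mapMaybe (λ y → h (x , y)) ys) xs ≡ mapMaybe h (cartesianProduct xs ys)
concatMap-mapMaybe h ys []       = refl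
concatMap-mapMaybe h ys (x ∷ xs) = begin
  mapMaybe (λ y → h (x , y)) ys ++ concatMap (λ x → mapMaybe (λ y → h (x , y)) ys) xs
    ≡⟨ cong₂ _++_ (cong List.catMaybes (List.map-∘ ys)) (concatMap-mapMaybe h ys xs) ⟩
  mapMaybe h (map (x ,_) ys) ++ mapMaybe h (cartesianProduct xs ys)
    ≡⟨ List.mapMaybe-++ h (map (x ,_) ys) (cartesianProduct xs ys) ⟨
  mapMaybe h (map (x ,_) ys ++ cartesianProduct xs ys) ∎
  where open ≡-Reasoning

nth-pos⇒< : ∀ xs i → 0 < nth xs i → i < length xs
nth-pos⇒< (x ∷ xs) zero    p = s≤s z≤n
nth-pos⇒< (x ∷ xs) (suc i) p = s≤s (nth-pos⇒< xs i p)

letterOf : Triple → ℕ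
letterOf (_ , _ , k) = k

ColumnOrder-irrefl : ∀ {x} → ¬ ColumnOrder x x
ColumnOrder-irrefl (inj₁ p)       = ℕ.n≮n _ p
ColumnOrder-irrefl (inj₂ (_ , p)) = ℕ.n≮n _ p

RowOrder-irrefl : ∀ {x} → ¬ RowOrder x x
RowOrder-irrefl (inj₁ p)       = ℕ.n≮n _ p
RowOrder-irrefl (inj₂ (_ , p)) = ℕ.n≮n _ p

module _ {m : ℕ} (P : HBPD (suc m)) where

  private
    n = suc m
    B = bpd P
    τ = tiles B
    r = height B
    T = ΩEntry P
    ƛ = HBPD.shape P
    rows = length (parts ƛ)

    -- Blanks are stored with the column first, so that the order of the product is the column
    -- reading order.
    blank? : (c : ℕ × ℕ) → Dec ((proj₂ c , proj₁ c) ∈ 𝕐 ƛ)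
    blank? (j , i) = ∈𝕐? ƛ i j

    blanks : List (ℕ × ℕ)
    blanks = filter blank? (cartesianProduct (upTo (ƛ ! 0)) (downFrom rows))

    crossing? : (c : ℕ × ℕ) → Dec (τ (proj₁ c) (proj₂ c) ≡ crossing)
    crossing? (a , b) = τ a b ≟ᵗ crossing

    crossings : List (ℕ × ℕ)
    crossings = filter crossing? (cartesianProduct (downFrom n) (upTo n))

    -- The truncated subtractions are exact on members: entries of blanks are positive, and both
    -- coordinates of a crossing exceed its height.
    ofBlank ofCrossing : ℕ × ℕ → Triple
    ofBlank (j , i)    = i , j , T i j ∸ 1
    ofCrossing (a , b) = a ∸ suc (r a b) , b ∸ suc (r a b) , r a b

    blankTriples crossingTriples : List Triple
    blankTriples    = map ofBlank blanks
    crossingTriples = map ofCrossing crossings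

    ∈-blanks⁻ : ∀ {c} → c ∈ˡ blanks → 0 < T (proj₂ c) (proj₁ c)
    ∈-blanks⁻ c∈ = to (shape⇔ΩEntry P)
      (proj₂ (∈-filter⁻ blank? {xs = cartesianProduct (upTo (ƛ ! 0)) (downFrom rows)} c∈))

    ∈-crossings⁻ : ∀ {c} → c ∈ˡ crossings → τ (proj₁ c) (proj₂ c) ≡ crossing
    ∈-crossings⁻ c∈ = proj₂ (∈-filter⁻ crossing? {xs = cartesianProduct (downFrom n) (upTo n)} c∈)

    ∈-blankTriples : ∀ {i j k} → (i , j , k) ∈ˡ blankTriples ⇔ T i j ≡ suc k
    ∈-blankTriples {i} {j} {k} = mk⇔ (λ x∈ → only (∈-map⁻ ofBlank x∈))
      λ eq → subst (λ k → (i , j , k) ∈ˡ blankTriples) (cong (_∸ 1) eq) (∈-map⁺ ofBlank (all eq))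
      where
      only : ∃ (λ c → c ∈ˡ blanks × (i , j , k) ≡ ofBlank c) → T i j ≡ suc k
      only ((j , i) , c∈ , refl) with T i j | ∈-blanks⁻ c∈
      ... | suc _ | _ = refl
      all : T i j ≡ suc k → (j , i) ∈ˡ blanks
      all eq = ∈-filter⁺ blank? (∈-cartesianProduct⁺
          (∈-upTo⁺ (𝕐-lower ƛ {j = j} {j} z≤n ℕ.≤-refl p))
          (∈-downFrom⁺ (nth-pos⇒< (parts ƛ) i (𝕐-lower ƛ {i = i} {i} ℕ.≤-refl z≤n p)))) p
        where
        p : (i , j) ∈ 𝕐 ƛ
        p = from (shape⇔ΩEntry P) (subst (0 <_) (sym eq) (s≤s z≤n))

    ∈-crossingTriples : ∀ {i j k} → (i , j , k) ∈ˡ crossingTriples ⇔ T i j ≡ suc k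
    ∈-crossingTriples {i} {j} {k} = mk⇔ (λ x∈ → only (∈-map⁻ ofCrossing x∈)) all
      where
      only : ∃ (λ c → c ∈ˡ crossings × (i , j , k) ≡ ofCrossing c) → T i j ≡ suc k
      only ((a , b) , c∈ , refl) with crossing-blank P {a} {b} (∈-crossings⁻ c∈)
      ... | i′ , j′ , a≡ , b≡ , eq = trans (cong₂ T
        (trans (cong (_∸ suc (r a b)) a≡) (ℕ.m+n∸m≡n (suc (r a b)) i′))
        (trans (cong (_∸ suc (r a b)) b≡) (ℕ.m+n∸m≡n (suc (r a b)) j′))) eq
      all : T i j ≡ suc k → (i , j , k) ∈ˡ crossingTriples
      all eq = subst (_∈ˡ crossingTriples)
        (trans (cong (λ q → suc (k + i) ∸ suc q , suc (k + j) ∸ suc q , q) (proj₂ cross))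
               (cong₂ (λ i j → i , j , k) (ℕ.m+n∸m≡n k i) (ℕ.m+n∸m≡n k j)))
        (∈-map⁺ ofCrossing (∈-filter⁺ crossing? (∈-cartesianProduct⁺
          (∈-downFrom⁺ (s≤s (subst (λ t → t + i ≤ m) eq (proj₁ within))))
          (∈-upTo⁺ (s≤s (subst (λ t → t + j ≤ m) eq (proj₂ within))))) (proj₁ cross)))
        where
        cross = entry⇒crossing P {k} {i} {j} eq
        within = entry-within P (subst (0 <_) (sym eq) (s≤s z≤n))

    blankTriples-sorted : AllPairs ColumnOrder blankTriples
    blankTriples-sorted = AllPairs.map⁺ (AllPairs.filter⁺ blank? (cartesianProduct-sorted
      (AllPairs.applyUpTo⁺₁ {R = _<_} (λ j → j) (ƛ ! 0) (λ p _ → p))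
      (AllPairs.applyDownFrom⁺₁ {R = _>_} (λ i → i) rows (λ p _ → p))))

    crossingTriples-sorted : AllPairs RowOrder crossingTriples
    crossingTriples-sorted = AllPairs.map⁺ (AllPairs-map-∈ ordered (AllPairs.filter⁺ crossing?
      (cartesianProduct-sorted
        (AllPairs.applyDownFrom⁺₁ {R = _>_} (λ a → a) n (λ p _ → p))
        (AllPairs.applyUpTo⁺₁ {R = _<_} (λ b → b) n (λ p _ → p)))))
      where
      row : ∀ {a b} → (a , b) ∈ˡ crossings → a ≡ suc (a ∸ suc (r a b) + r a b)
      row {a} {b} c∈ with crossing-blank P {a} {b} (∈-crossings⁻ c∈)
      ... | i , _ , a≡ , _ = trans (sym (ℕ.m∸n+n≡m {a} {suc (r a b)}
        (ℕ.≤-trans (ℕ.m≤m+n _ i) (ℕ.≤-reflexive (sym a≡))))) (ℕ.+-suc _ _)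
      col : ∀ {a b} → (a , b) ∈ˡ crossings → b ≡ suc (b ∸ suc (r a b) + r a b)
      col {a} {b} c∈ with crossing-blank P {a} {b} (∈-crossings⁻ c∈)
      ... | _ , j , _ , b≡ , _ = trans (sym (ℕ.m∸n+n≡m {b} {suc (r a b)}
        (ℕ.≤-trans (ℕ.m≤m+n _ j) (ℕ.≤-reflexive (sym b≡))))) (ℕ.+-suc _ _)
      ordered : ∀ {x y} → x ∈ˡ crossings → y ∈ˡ crossings → Lexicographic _>_ _<_ x y →
                RowOrder (ofCrossing x) (ofCrossing y)
      ordered x∈ y∈ (inj₁ p) = inj₁ (ℕ.≤-pred (subst₂ _<_ (row y∈) (row x∈) p))
      ordered x∈ y∈ (inj₂ (p , q)) = inj₂
        ( ℕ.suc-injective (trans (sym (row y∈)) (trans (sym p) (row x∈)))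
        , ℕ.≤-pred (subst₂ _<_ (col x∈) (col y∈) q))

  columnWord-letters : columnWord (Ω P) ≡ map (λ c → T (proj₂ c) (proj₁ c)) blanks
  columnWord-letters = trans (concatMap-mapMaybe (λ (j , i) → entry? (Ω P) i j) (downFrom rows) (upTo (ƛ ! 0)))
    (mapMaybe-filter blank? _ _ inside outside (cartesianProduct (upTo (ƛ ! 0)) (downFrom rows)))
    where
    inside : ∀ c → (proj₂ c , proj₁ c) ∈ 𝕐 ƛ → entry? (Ω P) (proj₂ c) (proj₁ c) ≡ just (T (proj₂ c) (proj₁ c))
    inside (j , i) p with j <? ƛ ! i
    ... | yes _ = refl
    ... | no ¬p = ⊥-elim (¬p p)
    outside : ∀ c → ¬ (proj₂ c , proj₁ c) ∈ 𝕐 ƛ → entry? (Ω P) (proj₂ c) (proj₁ c) ≡ nothing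
    outside (j , i) ¬p with j <? ƛ ! i
    ... | yes p = ⊥-elim (¬p p)
    ... | no _  = refl

  rowWords-letters : concatMap (λ a → rowWord (τ a) (r a) n) (downFrom n) ≡ map letterOf crossingTriples
  rowWords-letters = begin
    concatMap (λ a → rowWord (τ a) (r a) n) (downFrom n)
      ≡⟨ List.concatMap-cong (λ a → cong List.catMaybes (sym (List.map-upTo (λ b → h (a , b)) n))) (downFrom n) ⟩
    concatMap (λ a → mapMaybe (λ b → h (a , b)) (upTo n)) (downFrom n)
      ≡⟨ concatMap-mapMaybe h (upTo n) (downFrom n) ⟩
    mapMaybe h (cartesianProduct (downFrom n) (upTo n))
      ≡⟨ mapMaybe-filter crossing? h (λ (a , b) → r a b) inside outside (cartesianProduct (downFrom n) (upTo n)) ⟩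
    map (λ (a , b) → r a b) crossings
      ≡⟨ List.map-∘ crossings ⟩
    map letterOf crossingTriples ∎
    where
    open ≡-Reasoning
    h : ℕ × ℕ → Maybe ℕ
    h (a , b) = crossingLetter (τ a b) (r a b)
    inside : ∀ c → τ (proj₁ c) (proj₂ c) ≡ crossing → h c ≡ just (r (proj₁ c) (proj₂ c))
    inside (a , b) eq = cong (λ t → crossingLetter t (r a b)) eq
    outside : ∀ c → ¬ τ (proj₁ c) (proj₂ c) ≡ crossing → h c ≡ nothing
    outside (a , b) ≢ with τ a b
    ... | downElbow  = refl
    ... | upElbow    = refl
    ... | crossing   = ⊥-elim (≢ refl)
    ... | blank      = refl
    ... | horizontal = refl
    ... | vertical   = refl

  words-agree : ∀ s → sortAlong letterOf s blankTriples ≡ sortAlong letterOf s crossingTriples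
  words-agree = sortAlong-reorder letterOf (λ {x} → ColumnOrder-irrefl {x}) (λ {x} → RowOrder-irrefl {x})
    blankTriples blankTriples-sorted crossingTriples-sorted
    (λ _ → mk⇔ (from ∈-crossingTriples ∘ to ∈-blankTriples) (from ∈-blankTriples ∘ to ∈-crossingTriples))
    (λ x∈ y∈ → orders-far (ΩEntry-tableau P) (to ∈-blankTriples x∈) (to ∈-blankTriples y∈))

  columnWord-isHeckeWord : ∀ w → B ∈ Pipes w → IsHeckeWord w (columnWord (Ω P))
  columnWord-isHeckeWord w B∈ = isHeckeWord w
    (subst (All _) (sym columnWord-letters) (All.map⁺ (All.tabulate λ c∈ →
      ∈-blanks⁻ c∈ , IsTableau.bound (ΩEntry-tableau P) _ _)))
    (begin
      foldl sortAt start (map (_∸ 1) (columnWord (Ω P)))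
        ≡⟨ cong (λ as → foldl sortAt start (map (_∸ 1) as)) columnWord-letters ⟩
      foldl sortAt start (map (_∸ 1) (map (λ (j , i) → T i j) blanks))
        -- Both sides fuse to the same map, since the triple of a blank carries its entry minus 1.
        ≡⟨ cong (foldl sortAt start) (trans (sym (List.map-∘ blanks)) (List.map-∘ blanks)) ⟩
      foldl sortAt start (map letterOf blankTriples)     ≡⟨ List.foldl-map sortAt letterOf start blankTriples ⟩
      sortAlong letterOf start blankTriples              ≡⟨ words-agree start ⟩
      sortAlong letterOf start crossingTriples           ≡⟨ List.foldl-map sortAt letterOf start crossingTriples ⟨
      foldl sortAt start (map letterOf crossingTriples)  ≡⟨ cong (foldl sortAt start) rowWords-letters ⟨
      foldl sortAt start (concatMap (λ a → rowWord (τ a) (r a) n) (downFrom n)) ≡⟨ ∂-sorts B w B∈ ⟩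
      oneLine w                                       ∎)
    where
    open ≡-Reasoning
    start = List.tabulate {n = n} toℕ

theorem1p7 : (m : ℕ) →
    Σ[ Ω ∈ (HBPD (suc m) → DT m) ]
    ((∀ P → IsΩ P (Ω P)) ×
    (∀ P → DT.shape (Ω P) ≈ᵖ HBPD.shape P) ×
    IsBijection _≈ʰ_ _≈ᵗ_ Ω ×
    (∀ (P : HBPD (suc m)) (w : Permutation′ (suc m)) →
    bpd P ∈ Pipes w → IsHeckeWord w (columnWord (Ω P))))
theorem1p7 m = Ω , Ω-isΩ , (λ _ → refl) , Ω-bijection , columnWord-isHeckeWord
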